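{- Let $\lambda$ be a partition and let $\mathcal{S}$ and $\mathcal{T}$ be sets consisting of $m$ and $n$ variables, respectively. If $\Delta(\mathcal{S};\mathcal{T}) \neq 0$, then $$\mathfrak{s}_\lambda(\mathcal{S}\cup\mathcal{T}) = \sum_{\substack{\mu,\nu:\\ \mu\star_{m,n}\nu=\lambda}} \frac{\varepsilon_{m,n}(\mu,\nu)\,\mathfrak{s}_\mu(\mathcal{S})\,\mathfrak{s}_\nu(\mathcal{T})}{\Delta(\mathcal{S};\mathcal{T})},$$ where the sum is over all pairs of partitions $\mu,\nu$ (of length at most $m$ and $n$, respectively) whose $(m,n)$-overlap is $\lambda$.
   Context: Sets of variables are viewed as finite sequences (of elements of a field, e.g. indeterminates or complex numbers) in a fixed order; repetitions are allowed unless excluded. The union $\mathcal{A}\cup\mathcal{B}$ of two sequences is obtained by appending $\mathcal{B}$ to $\mathcal{A}$; sums of sequences are elementwise. $\Delta(\mathcal{X}) = \prod_{i<j}(\mathcal{X}_i-\mathcal{X}_j)$ and $\Delta(\mathcal{X};\mathcal{Y}) = \prod_{x\in\mathcal{X},y\in\mathcal{Y}}(x-y)$. A partition is a non-increasing sequence of non-negative integers; partitions differing only by trailing zeros are equal; its length $l(\lambda)$ is the number of positive parts. When used as a sequence of prescribed length, a partition is padded with zeros. Schur functions: for $\mathcal{X}$ of length $N$, $\mathfrak{s}_\lambda(\mathcal{X})=0$ if $l(\lambda)>N$, and otherwise $\mathfrak{s}_\lambda(\mathcal{X}) = \det(x^{\lambda_j+N-j})_{x\in\mathcal{X},1\le j\le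 N}/\Delta(\mathcal{X})$ (extended as a polynomial to repeated variables). Overlap: $\rho_n=(n-1,\dots,1,0)$ ($\rho_0$ is empty). For partitions $\mu,\nu$ of length at most $m$ and $n$, respectively, the $(m,n)$-overlap $\mu\star_{m,n}\nu$ is the partition (of length at most $m+n$) such that $\mu\star_{m,n}\nu+\rho_{m+n}$ equals $(\mu+\rho_m)\cup(\nu+\rho_n)$ up to reordering, if it exists; otherwise $\mu\star_{m,n}\nu=\infty$, a symbol that is not a partition. If the overlap is a partition, $\varepsilon_{m,n}(\mu,\nu)$ is the sign of the permutation sorting $(\mu+\rho_m)\cup(\nu+\rho_n)$ into the strictly decreasing sequence $\mu\star_{m,n}\nu+\rho_{m+n}$; otherwise $\varepsilon_{m,n}(\mu,\nu)=1$. -}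

module Defs where

open import Algebra.Apartness.Bundles using (HeytingCommutativeRing; HeytingField)
open import Algebra.Bundles using (CommutativeMonoid; CommutativeRing)
open import Data.Bool.Base using (if_then_else_)
open import Data.Fin.Base using (Fin; zero; suc; toℕ; punchIn; pinch; _↑ˡ_; _↑ʳ_)
open import Data.Fin.Permutation as Perm using (Permutation; _⟨$⟩ʳ_; _⟨$⟩ˡ_)
import Data.Fin.Permutation.Components as PC
import Data.Fin.Properties as Fin
open import Data.List.Base as List using (List; []; _∷_; cartesianProduct; cartesianProductWith; filter; upTo)
open import Data.List.Membership.Propositional using (_∈_; find; lose)
open import Data.List.Membership.Propositional.Properties using (∈-cartesianProduct⁺; ∈-cartesianProductWith⁺; ∈-filter⁺; ∈-upTo⁺)
import Data.List.Properties as List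
open import Data.List.Relation.Unary.All as All using (All; []; _∷_)
import Data.List.Relation.Unary.All.Properties as All
open import Data.List.Relation.Unary.AllPairs using ([]; _∷_)
open import Data.List.Relation.Unary.Any using (here; there; any?)
open import Data.List.Relation.Unary.Linked as Linked using (Linked)
open import Data.List.Relation.Unary.Unique.Propositional using (Unique)
import Data.List.Relation.Unary.Unique.Propositional.Properties as Unique
open import Data.Maybe.Base using (Maybe; just; nothing)
import Data.Maybe.Properties as Maybe
open import Data.Nat.Base as ℕ using (ℕ; zero; suc; _∸_; _≤_; _<_; _≥_; s≤s; z≤n)
open import Data.Nat.Properties as ℕ using (_≤?_; _<?_; _≥?_; ≤-trans; m≤m+n; m≤n+m)
open import Data.Product.Base using (_×_; _,_; proj₁; proj₂; Σ-syntax; ∃-syntax)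
open import Data.Sign.Base using (Sign)
import Data.Sign.Properties as Sign
open import Data.Vec.Functional as Vector using (Vector; head; tail; removeAt; _++_)
open import Data.Vec.Functional.Properties using (lookup-++ˡ; lookup-++ʳ)
open import Data.Vec.Functional.Relation.Binary.Permutation using (_↭_)
open import Function.Base using (_∘_)
open import Level using (Level; _⊔_)
open import Relation.Binary.Definitions using (DecidableEquality)
open import Relation.Binary.PropositionalEquality as ≡ using (_≡_)
open import Relation.Binary.Structures using (IsEquivalence)
open import Relation.Nullary.Decidable using (Dec; yes; no; map′; _×-dec_; does)
open import Relation.Nullary.Negation using (¬_; contradiction)
open import Relation.Unary using (Pred)

private
  variable
    a p c ℓ ℓ₁ ℓ₂ : Level

module PairProduct (M : CommutativeMonoid c ℓ) where
  open CommutativeMonoid M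
  open import Algebra.Properties.CommutativeMonoid.Sum M using (sum)

  -- ∏ f i j over i < j.
  pairs : ∀ {n} → (Fin n → Fin n → Carrier) → Carrier
  pairs {zero}  f = ε
  pairs {suc n} f = sum (λ j → f zero (suc j)) ∙ pairs (λ i j → f (suc i) (suc j))

module Vandermonde (R : CommutativeRing c ℓ) where
  open CommutativeRing R hiding (zero)
  open import Algebra.Properties.CommutativeMonoid.Sum *-commutativeMonoid public
    using () renaming (sum to product)
  open PairProduct *-commutativeMonoid

  Δ : ∀ {n} → Vector Carrier n → Carrier
  Δ x = pairs (λ i j → x i - x j)

  Δ[_⨾_] : ∀ {m n} → Vector Carrier m → Vector Carrier n → Carrier
  Δ[ x ⨾ y ] = product (λ i → product (λ j → x i - y j))

module Determinant (R : CommutativeRing c ℓ) where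
  open CommutativeRing R hiding (zero)
  open import Algebra.Properties.Semiring.Exp semiring using (_^_)
  open import Algebra.Properties.Semiring.Sum semiring using (sum)

  det : ∀ {n} → (Fin n → Fin n → Carrier) → Carrier
  det {zero}  A = 1#
  det {suc n} A = sum λ j →
    (- 1#) ^ toℕ j * (A zero j * det (λ i k → A (suc i) (punchIn j k)))

module DeterminantProperties (R : CommutativeRing c ℓ) where
  open CommutativeRing R hiding (zero)
  open Determinant R
  open import Algebra.Properties.Ring ring
  open import Algebra.Properties.Semiring.Exp semiring using (_^_)
  open import Algebra.Properties.Semiring.Sum semiring
  open import Algebra.Properties.CommutativeMonoid.Sum *-commutativeMonoid
    using () renaming (sum to product)
  open import Relation.Binary.Reasoning.Setoid setoid
  open import Algebra.Solver.Ring.NaturalCoefficients.Default commutativeSemiring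
    using (solve; _:=_; _:+_; _:*_)

  Matrix : ℕ → Set _
  Matrix n = Fin n → Fin n → Carrier

  minor : ∀ {n} → Matrix (suc n) → Fin (suc n) → Matrix n
  minor A j i k = A (suc i) (punchIn j k)

  sg : ∀ {n} → Fin n → Carrier
  sg j = (- 1#) ^ toℕ j

  det-cong : ∀ {n} {A B : Matrix n} → (∀ i j → A i j ≈ B i j) → det A ≈ det B
  det-cong {zero}  A≈B = refl
  det-cong {suc n} A≈B = sum-cong-≋ λ j →
    *-congˡ {x = sg j} (*-cong (A≈B zero j) (det-cong λ i k → A≈B (suc i) (punchIn j k)))

  det-linear : ∀ {n} (A B C : Matrix n) (d : Carrier) (i : Fin n) →
               (∀ j → A i j ≈ B i j + d * C i j) →
               (∀ k → ¬ k ≡ i → ∀ j → A k j ≈ B k j) →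
               (∀ k → ¬ k ≡ i → ∀ j → A k j ≈ C k j) →
               det A ≈ det B + d * det C
  det-linear {suc n} A B C d i Ai A≈B A≈C = begin
    sum (λ j → term A j)                              ≈⟨ sum-cong-≋ (step i Ai A≈B A≈C) ⟩
    sum (λ j → term B j + d * term C j)               ≈⟨ ∑-distrib-+ (term B) (λ j → d * term C j) ⟩
    sum (term B) + sum (λ j → d * term C j)           ≈⟨ +-congˡ (*-distribˡ-sum d (term C)) ⟨
    sum (term B) + d * sum (term C)                   ∎
    where
    term : Matrix (suc n) → Fin (suc n) → Carrier
    term M j = sg j * (M zero j * det (minor M j))

    step : ∀ i →
           (∀ j → A i j ≈ B i j + d * C i j) →
           (∀ k → ¬ k ≡ i → ∀ j → A k j ≈ B k j) →
           (∀ k → ¬ k ≡ i → ∀ j → A k j ≈ C k j) →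
           ∀ j → term A j ≈ term B j + d * term C j
    step zero Ai A≈B A≈C j = begin
      sg j * (A zero j * det (minor A j))
        ≈⟨ *-congˡ (*-congʳ (Ai j)) ⟩
      sg j * ((B zero j + d * C zero j) * det (minor A j))
        ≈⟨ solve 5 (λ s b d c m → s :* ((b :+ d :* c) :* m) := s :* (b :* m) :+ d :* (s :* (c :* m))) refl (sg j) (B zero j) d (C zero j) (det (minor A j)) ⟩
      sg j * (B zero j * det (minor A j)) + d * (sg j * (C zero j * det (minor A j)))
        ≈⟨ +-cong (*-congˡ (*-congˡ (det-cong λ i k → A≈B (suc i) (λ ()) (punchIn j k))))
                  (*-congˡ (*-congˡ (*-congˡ (det-cong λ i k → A≈C (suc i) (λ ()) (punchIn j k))))) ⟩
      term B j + d * term C j ∎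
    step (suc i) Ai A≈B A≈C j = begin
      sg j * (A zero j * det (minor A j))
        ≈⟨ *-congˡ (*-congˡ (det-linear (minor A j) (minor B j) (minor C j) d i
             (λ k → Ai (punchIn j k))
             (λ k k≢i l → A≈B (suc k) (λ { ≡.refl → k≢i ≡.refl }) (punchIn j l))
             (λ k k≢i l → A≈C (suc k) (λ { ≡.refl → k≢i ≡.refl }) (punchIn j l)))) ⟩
      sg j * (A zero j * (det (minor B j) + d * det (minor C j)))
        ≈⟨ solve 5 (λ s a d b c → s :* (a :* (b :+ d :* c)) := s :* (a :* b) :+ d :* (s :* (a :* c))) refl (sg j) (A zero j) d (det (minor B j)) (det (minor C j)) ⟩
      sg j * (A zero j * det (minor B j)) + d * (sg j * (A zero j * det (minor C j)))
        ≈⟨ +-cong (*-congˡ (*-congʳ (A≈B zero (λ ()) j))) (*-congˡ (*-congˡ (*-congʳ (A≈C zero (λ ()) j)))) ⟩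
      term B j + d * term C j ∎

  sum-swap : ∀ {n} (f : Fin (suc n) → Fin n → Carrier) →
             sum (λ j → sum (λ k → f j k)) ≈ sum (λ j → sum (λ k → f (punchIn j k) (pinch k j)))
  sum-swap {zero}  f = refl
  sum-swap {suc n} f = begin
    sum (λ k → f zero k) + sum (λ j → f (suc j) zero + sum (λ k → f (suc j) (suc k)))
      ≈⟨ +-congˡ (∑-distrib-+ (λ j → f (suc j) zero) (λ j → sum (λ k → f (suc j) (suc k)))) ⟩
    sum (λ k → f zero k) + (sum (λ j → f (suc j) zero) + sum (λ j → sum (λ k → f (suc j) (suc k))))
      ≈⟨ +-congˡ (+-congˡ (sum-swap (λ j k → f (suc j) (suc k)))) ⟩
    sum (λ k → f zero k) + (sum (λ j → f (suc j) zero) + sum (λ j → sum (λ k → f (suc (punchIn j k)) (suc (pinch k j)))))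
      ≈⟨ solve 3 (λ a b c → a :+ (b :+ c) := b :+ (a :+ c)) refl _ _ _ ⟩
    sum (λ j → f (suc j) zero) + (sum (λ k → f zero k) + sum (λ j → sum (λ k → f (suc (punchIn j k)) (suc (pinch k j)))))
      ≈⟨ +-congˡ (∑-distrib-+ (λ k → f zero k) (λ j → sum (λ k → f (suc (punchIn j k)) (suc (pinch k j))))) ⟨
    sum (λ j → f (suc j) zero) + sum (λ j → f zero j + sum (λ k → f (suc (punchIn j k)) (suc (pinch k j)))) ∎

  sum-antisym : ∀ {n} (f : Fin (suc n) → Fin n → Carrier) →
                (∀ j k → f (punchIn j k) (pinch k j) ≈ - f j k) →
                sum (λ j → sum (λ k → f j k)) ≈ 0#
  sum-antisym {zero}  f anti = +-identityʳ 0#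
  sum-antisym {suc n} f anti = begin
    sum (λ k → f zero k) + sum (λ j → f (suc j) zero + sum (λ k → f (suc j) (suc k)))
      ≈⟨ +-congˡ (∑-distrib-+ (λ j → f (suc j) zero) (λ j → sum (λ k → f (suc j) (suc k)))) ⟩
    sum (λ k → f zero k) + (sum (λ j → f (suc j) zero) + sum (λ j → sum (λ k → f (suc j) (suc k))))
      ≈⟨ +-assoc _ _ _ ⟨
    sum (λ k → f zero k) + sum (λ j → f (suc j) zero) + sum (λ j → sum (λ k → f (suc j) (suc k)))
      ≈⟨ +-congˡ (sum-antisym (λ j k → f (suc j) (suc k)) (λ j k → anti (suc j) (suc k))) ⟩
    sum (λ k → f zero k) + sum (λ j → f (suc j) zero) + 0#
      ≈⟨ +-identityʳ _ ⟩
    sum (λ k → f zero k) + sum (λ j → f (suc j) zero)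
      ≈⟨ ∑-distrib-+ (λ k → f zero k) (λ j → f (suc j) zero) ⟨
    sum (λ k → f zero k + f (suc k) zero)
      ≈⟨ sum-cong-≋ (λ k → trans (+-congˡ (anti zero k)) (-‿inverseʳ _)) ⟩
    sum {suc n} (λ k → 0#)
      ≈⟨ sum-replicate-zero (suc n) ⟩
    0# ∎

  punchIn-pinch : ∀ {n} (j : Fin (suc n)) (k : Fin n) → punchIn (punchIn j k) (pinch k j) ≡ j
  punchIn-pinch {suc n} zero    k       = ≡.refl
  punchIn-pinch {suc n} (suc j) zero    = ≡.refl
  punchIn-pinch {suc n} (suc j) (suc k) = ≡.cong suc (punchIn-pinch j k)

  punchIn-swap : ∀ {n} (j : Fin (suc (suc n))) (k : Fin (suc n)) (m : Fin n) →
                 punchIn (punchIn j k) (punchIn (pinch k j) m) ≡ punchIn j (punchIn k m)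
  punchIn-swap zero    k       m       = ≡.refl
  punchIn-swap (suc j) zero    m       = ≡.refl
  punchIn-swap (suc j) (suc k) zero    = ≡.refl
  punchIn-swap (suc j) (suc k) (suc m) = ≡.cong suc (punchIn-swap j k m)

  sg-swap : ∀ {n} (j : Fin (suc n)) (k : Fin n) → sg (punchIn j k) * sg (pinch k j) ≈ - (sg j * sg k)
  sg-swap {suc n} zero    k = begin
    (- 1# * sg k) * 1#  ≈⟨ *-identityʳ _ ⟩
    - 1# * sg k         ≈⟨ -1*x≈-x _ ⟩
    - sg k              ≈⟨ -‿cong (*-identityˡ _) ⟨
    - (1# * sg k)       ∎
  sg-swap {suc n} (suc j) zero = begin
    1# * sg j           ≈⟨ *-identityˡ _ ⟩
    sg j                ≈⟨ -‿involutive _ ⟨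
    - (- sg j)          ≈⟨ -‿cong (-1*x≈-x _) ⟨
    - (- 1# * sg j)     ≈⟨ -‿cong (*-identityʳ _) ⟨
    - (- 1# * sg j * 1#) ∎
  sg-swap {suc n} (suc j) (suc k) = begin
    (- 1# * sg (punchIn j k)) * (- 1# * sg (pinch k j))
      ≈⟨ solve 3 (λ e a b → (e :* a) :* (e :* b) := (e :* e) :* (a :* b)) refl (- 1#) _ _ ⟩
    (- 1# * - 1#) * (sg (punchIn j k) * sg (pinch k j))
      ≈⟨ *-congˡ (sg-swap j k) ⟩
    (- 1# * - 1#) * - (sg j * sg k)
      ≈⟨ -‿distribʳ-* _ _ ⟨
    - ((- 1# * - 1#) * (sg j * sg k))
      ≈⟨ -‿cong (solve 3 (λ e a b → (e :* e) :* (a :* b) := (e :* a) :* (e :* b)) refl (- 1#) _ _) ⟩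
    - ((- 1# * sg j) * (- 1# * sg k)) ∎

  swap₀₁ : ∀ {n} {a} {A : Set a} → Vector A (suc (suc n)) → Vector A (suc (suc n))
  swap₀₁ A zero          = A (suc zero)
  swap₀₁ A (suc zero)    = A zero
  swap₀₁ A (suc (suc i)) = A (suc (suc i))

  module _ {n : ℕ} where
    term₂ : Matrix (suc (suc n)) → Fin (suc (suc n)) → Fin (suc n) → Carrier
    term₂ M j k = (sg j * sg k) * (M zero j * M (suc zero) (punchIn j k) * det (minor (minor M j) k))

    expand₂ : ∀ M → det M ≈ sum (λ j → sum (λ k → term₂ M j k))
    expand₂ M = sum-cong-≋ λ j → begin
      sg j * (M zero j * sum (inner j))
        ≈⟨ *-congˡ (*-distribˡ-sum (M zero j) (inner j)) ⟩
      sg j * sum (λ k → M zero j * inner j k)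
        ≈⟨ *-distribˡ-sum (sg j) (λ k → M zero j * inner j k) ⟩
      sum (λ k → sg j * (M zero j * inner j k))
        ≈⟨ sum-cong-≋ {n = suc n} (λ k → solve 5 (λ s a t b d → s :* (a :* (t :* (b :* d))) := (s :* t) :* (a :* b :* d)) refl
             (sg j) (M zero j) (sg k) (minor M j zero k) (det (minor (minor M j) k))) ⟩
      sum (λ k → term₂ M j k) ∎
      where
      inner : Fin (suc (suc n)) → Fin (suc n) → Carrier
      inner j k = sg k * (minor M j zero k * det (minor (minor M j) k))

    term₂-swap : ∀ A j k → term₂ (swap₀₁ A) (punchIn j k) (pinch k j) ≈ - term₂ A j k
    term₂-swap A j k = begin
      (sg (punchIn j k) * sg (pinch k j)) * (A (suc zero) (punchIn j k) * A zero (punchIn (punchIn j k) (pinch k j)) * D′)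
        ≈⟨ *-cong (sg-swap j k) (*-cong (*-congˡ (reflexive (≡.cong (A zero) (punchIn-pinch j k))))
             (det-cong λ i m → reflexive (≡.cong (A (suc (suc i))) (punchIn-swap j k m)))) ⟩
      - (sg j * sg k) * (A (suc zero) (punchIn j k) * A zero j * D)
        ≈⟨ -‿distribˡ-* _ _ ⟨
      - ((sg j * sg k) * (A (suc zero) (punchIn j k) * A zero j * D))
        ≈⟨ -‿cong (*-congˡ (*-congʳ (*-comm _ _))) ⟩
      - term₂ A j k ∎
      where
      D  = det (minor (minor A j) k)
      D′ = det (minor (minor (swap₀₁ A) (punchIn j k)) (pinch k j))

  det-swap : ∀ {n} (A : Matrix (suc (suc n))) → det (swap₀₁ A) ≈ - det A
  det-swap A = begin
    det (swap₀₁ A)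
      ≈⟨ expand₂ (swap₀₁ A) ⟩
    sum (λ j → sum (λ k → term₂ (swap₀₁ A) j k))
      ≈⟨ sum-swap (term₂ (swap₀₁ A)) ⟩
    sum (λ j → sum (λ k → term₂ (swap₀₁ A) (punchIn j k) (pinch k j)))
      ≈⟨ sum-cong-≋ (λ j → sum-cong-≋ (λ k → trans (term₂-swap A j k) (sym (-1*x≈-x _)))) ⟩
    sum (λ j → sum (λ k → - 1# * term₂ A j k))
      ≈⟨ sum-cong-≋ (λ j → sym (*-distribˡ-sum (- 1#) (term₂ A j))) ⟩
    sum (λ j → - 1# * sum (λ k → term₂ A j k))
      ≈⟨ *-distribˡ-sum (- 1#) (λ j → sum (term₂ A j)) ⟨
    - 1# * sum (λ j → sum (λ k → term₂ A j k))
      ≈⟨ -1*x≈-x _ ⟩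
    - sum (λ j → sum (λ k → term₂ A j k))
      ≈⟨ -‿cong (expand₂ A) ⟨
    - det A ∎

  det-alternating : ∀ {n} (A : Matrix (suc n)) (i : Fin n) →
                    (∀ j → A zero j ≈ A (suc i) j) → det A ≈ 0#
  det-alternating {suc n} A zero A₀≈A₁ = trans (expand₂ A) (sum-antisym (term₂ A) λ j k → begin
    term₂ A (punchIn j k) (pinch k j)
      ≈⟨ *-congˡ (*-congʳ (*-cong (A₀≈A₁ _) (sym (A₀≈A₁ _)))) ⟩
    term₂ (swap₀₁ A) (punchIn j k) (pinch k j)
      ≈⟨ term₂-swap A j k ⟩
    - term₂ A j k ∎)
  det-alternating {suc n} A (suc i) A₀≈Aᵢ = begin
    det A          ≈⟨ -‿involutive _ ⟨
    - (- det A)    ≈⟨ -‿cong (det-swap A) ⟨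
    - det (swap₀₁ A) ≈⟨ -‿cong (begin
      sum (λ j → sg j * (A (suc zero) j * det (minor (swap₀₁ A) j)))
        ≈⟨ sum-cong-≋ (λ j → trans (*-congˡ {x = sg j} (trans (*-congˡ {x = A (suc zero) j} (vanish j)) (zeroʳ _))) (zeroʳ _)) ⟩
      sum {suc (suc n)} (λ j → 0#)
        ≈⟨ sum-replicate-zero (suc (suc n)) ⟩
      0# ∎) ⟩
    - 0#           ≈⟨ -0#≈0# ⟩
    0# ∎
    where
    vanish : ∀ j → det (minor (swap₀₁ A) j) ≈ 0#
    vanish j = det-alternating (minor (swap₀₁ A) j) i (λ k → A₀≈Aᵢ (punchIn j k))

  det-scaleRows : ∀ {n} (r : Vector Carrier (suc n)) (d : Vector Carrier n) (E : Fin n → Vector Carrier (suc n)) →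
                  det (r Vector.∷ λ i j → r j + d i * E i j) ≈ product d * det (r Vector.∷ E)
  det-scaleRows {n} r d E = go n (λ B → det (r Vector.∷ B))
    (λ {B} {B′} B≈B′ → det-cong {A = r Vector.∷ B} {B = r Vector.∷ B′} λ { zero _ → refl ; (suc i) → B≈B′ i })
    (λ A B C d i Aᵢ A≈B A≈C → det-linear (r Vector.∷ A) (r Vector.∷ B) (r Vector.∷ C) d (suc i) Aᵢ
      (λ { zero _ _ → refl ; (suc k) k≢i → A≈B k (λ { ≡.refl → k≢i ≡.refl }) })
      (λ { zero _ _ → refl ; (suc k) k≢i → A≈C k (λ { ≡.refl → k≢i ≡.refl }) }))
    (λ B i r≈Bᵢ → det-alternating (r Vector.∷ B) i r≈Bᵢ)
    d E
    where
    Rows : ℕ → Set _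
    Rows k = Fin k → Vector Carrier (suc n)

    go : ∀ k (F : Rows k → Carrier) →
         (∀ {A B} → (∀ i j → A i j ≈ B i j) → F A ≈ F B) →
         (∀ A B C d i → (∀ j → A i j ≈ B i j + d * C i j) →
            (∀ k → ¬ k ≡ i → ∀ j → A k j ≈ B k j) →
            (∀ k → ¬ k ≡ i → ∀ j → A k j ≈ C k j) → F A ≈ F B + d * F C) →
         (∀ A i → (∀ j → r j ≈ A i j) → F A ≈ 0#) →
         ∀ d E → F (λ i j → r j + d i * E i j) ≈ product d * F E
    go zero F cong lin alt d E = trans (cong λ ()) (sym (*-identityˡ _))
    go (suc k) F cong lin alt d E = begin
      F A
        ≈⟨ lin A (r Vector.∷ tail A) (head E Vector.∷ tail A) (head d) zero (λ j → refl)
             (λ { zero z≢z → contradiction ≡.refl z≢z ; (suc i) _ j → refl })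
             (λ { zero z≢z → contradiction ≡.refl z≢z ; (suc i) _ j → refl }) ⟩
      F (r Vector.∷ tail A) + head d * F (head E Vector.∷ tail A)
        ≈⟨ +-cong (alt _ zero (λ j → refl))
             (*-congˡ (go k (λ B → F (head E Vector.∷ B))
               (λ B≈B′ → cong λ { zero _ → refl ; (suc i) → B≈B′ i })
               (λ A B C d i Aᵢ A≈B A≈C → lin (head E Vector.∷ A) (head E Vector.∷ B) (head E Vector.∷ C) d (suc i) Aᵢ
                 (λ { zero _ _ → refl ; (suc k) k≢i → A≈B k (λ { ≡.refl → k≢i ≡.refl }) })
                 (λ { zero _ _ → refl ; (suc k) k≢i → A≈C k (λ { ≡.refl → k≢i ≡.refl }) }))
               (λ B i → alt (head E Vector.∷ B) (suc i))
               (tail d) (tail E))) ⟩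
      0# + head d * (product (tail d) * F (head E Vector.∷ tail E))
        ≈⟨ +-identityˡ _ ⟩
      head d * (product (tail d) * F (head E Vector.∷ tail E))
        ≈⟨ *-assoc _ _ _ ⟨
      product d * F (head E Vector.∷ tail E)
        ≈⟨ *-congˡ (cong λ { zero _ → refl ; (suc i) _ → refl }) ⟩
      product d * F E ∎
      where
      A : Rows (suc k)
      A i j = r j + d i * E i j

module PolynomialRing (R : CommutativeRing c ℓ) where
  open CommutativeRing R hiding (zero)
  open import Algebra.Properties.Ring ring
  open import Relation.Binary.Reasoning.Setoid setoid
  open import Algebra.Solver.Ring.NaturalCoefficients.Default commutativeSemiring
    using (solve; _:=_; _:+_; _:*_)

  -- Lists of coefficients, constant term first; trailing zeros are identified by _≈ₚ_.
  Polynomial : Set _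
  Polynomial = List Carrier

  coeff : Polynomial → ℕ → Carrier
  coeff []      i       = 0#
  coeff (a ∷ p) zero    = a
  coeff (a ∷ p) (suc i) = coeff p i

  infix 4 _≈ₚ_

  _≈ₚ_ : Polynomial → Polynomial → Set _
  p ≈ₚ q = ∀ i → coeff p i ≈ coeff q i

  infixl 6 _+ₚ_
  infixl 7 _*ₚ_

  _+ₚ_ : Polynomial → Polynomial → Polynomial
  []      +ₚ q       = q
  (a ∷ p) +ₚ []      = a ∷ p
  (a ∷ p) +ₚ (b ∷ q) = a + b ∷ p +ₚ q

  scale : Carrier → Polynomial → Polynomial
  scale a = List.map (a *_)

  _*ₚ_ : Polynomial → Polynomial → Polynomial
  []      *ₚ q = []
  (a ∷ p) *ₚ q = scale a q +ₚ (0# ∷ p *ₚ q)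

  -ₚ_ : Polynomial → Polynomial
  -ₚ_ = List.map (λ a → - a)

  constant : Carrier → Polynomial
  constant a = a ∷ []

  coeff-+ : ∀ p q i → coeff (p +ₚ q) i ≈ coeff p i + coeff q i
  coeff-+ []      q       i       = sym (+-identityˡ _)
  coeff-+ (a ∷ p) []      i       = sym (+-identityʳ _)
  coeff-+ (a ∷ p) (b ∷ q) zero    = refl
  coeff-+ (a ∷ p) (b ∷ q) (suc i) = coeff-+ p q i

  coeff-scale : ∀ a p i → coeff (scale a p) i ≈ a * coeff p i
  coeff-scale a []      i       = sym (zeroʳ a)
  coeff-scale a (b ∷ p) zero    = refl
  coeff-scale a (b ∷ p) (suc i) = coeff-scale a p i

  coeff-neg : ∀ p i → coeff (-ₚ p) i ≈ - coeff p i
  coeff-neg []      i       = sym -0#≈0#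
  coeff-neg (a ∷ p) zero    = refl
  coeff-neg (a ∷ p) (suc i) = coeff-neg p i

  conv : (f g : ℕ → Carrier) → ℕ → Carrier
  conv f g zero    = f 0 * g 0
  conv f g (suc n) = f 0 * g (suc n) + conv (f ∘ suc) g n

  conv-cong : ∀ {f f′ g g′} → (∀ i → f i ≈ f′ i) → (∀ i → g i ≈ g′ i) → ∀ n → conv f g n ≈ conv f′ g′ n
  conv-cong f≈f′ g≈g′ zero    = *-cong (f≈f′ 0) (g≈g′ 0)
  conv-cong f≈f′ g≈g′ (suc n) = +-cong (*-cong (f≈f′ 0) (g≈g′ (suc n))) (conv-cong (f≈f′ ∘ suc) g≈g′ n)

  conv-0 : ∀ {f} g → (∀ i → f i ≈ 0#) → ∀ n → conv f g n ≈ 0#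
  conv-0 g f≈0 zero    = trans (*-congʳ (f≈0 0)) (zeroˡ _)
  conv-0 g f≈0 (suc n) = trans (+-cong (trans (*-congʳ (f≈0 0)) (zeroˡ _)) (conv-0 g (f≈0 ∘ suc) n)) (+-identityˡ 0#)

  conv-last : ∀ f g n → conv f g (suc n) ≈ f (suc n) * g 0 + conv f (g ∘ suc) n
  conv-last f g zero    = +-comm _ _
  conv-last f g (suc n) = begin
    f 0 * g (suc (suc n)) + conv (f ∘ suc) g (suc n)
      ≈⟨ +-congˡ (conv-last (f ∘ suc) g n) ⟩
    f 0 * g (suc (suc n)) + (f (suc (suc n)) * g 0 + conv (f ∘ suc) (g ∘ suc) n)
      ≈⟨ solve 3 (λ a b c → a :+ (b :+ c) := b :+ (a :+ c)) refl _ _ _ ⟩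
    f (suc (suc n)) * g 0 + conv f (g ∘ suc) (suc n) ∎

  conv-comm : ∀ f g n → conv f g n ≈ conv g f n
  conv-comm f g zero    = *-comm _ _
  conv-comm f g (suc n) = begin
    conv f g (suc n)                     ≈⟨ conv-last f g n ⟩
    f (suc n) * g 0 + conv f (g ∘ suc) n ≈⟨ +-cong (*-comm _ _) (conv-comm f (g ∘ suc) n) ⟩
    conv g f (suc n)                     ∎

  conv-distribʳ : ∀ f g h n → conv (λ i → f i + g i) h n ≈ conv f h n + conv g h n
  conv-distribʳ f g h zero    = distribʳ _ _ _
  conv-distribʳ f g h (suc n) = begin
    (f 0 + g 0) * h (suc n) + conv (λ i → f (suc i) + g (suc i)) h n
      ≈⟨ +-cong (distribʳ _ _ _) (conv-distribʳ (f ∘ suc) (g ∘ suc) h n) ⟩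
    (f 0 * h (suc n) + g 0 * h (suc n)) + (conv (f ∘ suc) h n + conv (g ∘ suc) h n)
      ≈⟨ solve 4 (λ a b c d → (a :+ b) :+ (c :+ d) := (a :+ c) :+ (b :+ d)) refl _ _ _ _ ⟩
    conv f h (suc n) + conv g h (suc n) ∎

  conv-scale : ∀ a f g n → conv (λ i → a * f i) g n ≈ a * conv f g n
  conv-scale a f g zero    = *-assoc _ _ _
  conv-scale a f g (suc n) = trans (+-cong (*-assoc _ _ _) (conv-scale a (f ∘ suc) g n)) (sym (distribˡ _ _ _))

  conv-assoc : ∀ f g h n → conv (conv f g) h n ≈ conv f (conv g h) n
  conv-assoc f g h zero    = *-assoc _ _ _
  conv-assoc f g h (suc n) = begin
    f 0 * g 0 * h (suc n) + conv (λ i → f 0 * g (suc i) + conv (f ∘ suc) g i) h n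
      ≈⟨ +-congˡ (conv-distribʳ (λ i → f 0 * g (suc i)) (conv (f ∘ suc) g) h n) ⟩
    f 0 * g 0 * h (suc n) + (conv (λ i → f 0 * g (suc i)) h n + conv (conv (f ∘ suc) g) h n)
      ≈⟨ +-congˡ (+-cong (conv-scale (f 0) (g ∘ suc) h n) (conv-assoc (f ∘ suc) g h n)) ⟩
    f 0 * g 0 * h (suc n) + (f 0 * conv (g ∘ suc) h n + conv (f ∘ suc) (conv g h) n)
      ≈⟨ solve 5 (λ a b c d e → a :* b :* c :+ (a :* d :+ e) := a :* (b :* c :+ d) :+ e) refl _ _ _ _ _ ⟩
    conv f (conv g h) (suc n) ∎

  coeff-* : ∀ p q n → coeff (p *ₚ q) n ≈ conv (coeff p) (coeff q) n
  coeff-* []      q n       = sym (conv-0 (coeff q) (λ i → refl) n)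
  coeff-* (a ∷ p) q zero    = begin
    coeff (scale a q +ₚ (0# ∷ p *ₚ q)) 0 ≈⟨ coeff-+ (scale a q) _ 0 ⟩
    coeff (scale a q) 0 + 0#             ≈⟨ +-identityʳ _ ⟩
    coeff (scale a q) 0                  ≈⟨ coeff-scale a q 0 ⟩
    a * coeff q 0                        ∎
  coeff-* (a ∷ p) q (suc n) = begin
    coeff (scale a q +ₚ (0# ∷ p *ₚ q)) (suc n)    ≈⟨ coeff-+ (scale a q) _ (suc n) ⟩
    coeff (scale a q) (suc n) + coeff (p *ₚ q) n ≈⟨ +-cong (coeff-scale a q (suc n)) (coeff-* p q n) ⟩
    a * coeff q (suc n) + conv (coeff p) (coeff q) n ∎

  *ₚ-cong : ∀ {p p′ q q′} → p ≈ₚ p′ → q ≈ₚ q′ → p *ₚ q ≈ₚ p′ *ₚ q′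
  *ₚ-cong {p} {p′} {q} {q′} p≈p′ q≈q′ n = begin
    coeff (p *ₚ q) n             ≈⟨ coeff-* p q n ⟩
    conv (coeff p) (coeff q) n   ≈⟨ conv-cong p≈p′ q≈q′ n ⟩
    conv (coeff p′) (coeff q′) n ≈⟨ coeff-* p′ q′ n ⟨
    coeff (p′ *ₚ q′) n           ∎

  *ₚ-comm : ∀ p q → p *ₚ q ≈ₚ q *ₚ p
  *ₚ-comm p q n = begin
    coeff (p *ₚ q) n           ≈⟨ coeff-* p q n ⟩
    conv (coeff p) (coeff q) n ≈⟨ conv-comm (coeff p) (coeff q) n ⟩
    conv (coeff q) (coeff p) n ≈⟨ coeff-* q p n ⟨
    coeff (q *ₚ p) n           ∎

  *ₚ-assoc : ∀ p q r → (p *ₚ q) *ₚ r ≈ₚ p *ₚ (q *ₚ r)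
  *ₚ-assoc p q r n = begin
    coeff ((p *ₚ q) *ₚ r) n                     ≈⟨ coeff-* (p *ₚ q) r n ⟩
    conv (coeff (p *ₚ q)) (coeff r) n           ≈⟨ conv-cong (coeff-* p q) (λ i → refl) n ⟩
    conv (conv (coeff p) (coeff q)) (coeff r) n ≈⟨ conv-assoc (coeff p) (coeff q) (coeff r) n ⟩
    conv (coeff p) (conv (coeff q) (coeff r)) n ≈⟨ conv-cong (λ i → refl) (coeff-* q r) n ⟨
    conv (coeff p) (coeff (q *ₚ r)) n           ≈⟨ coeff-* p (q *ₚ r) n ⟨
    coeff (p *ₚ (q *ₚ r)) n                     ∎

  *ₚ-identityˡ : ∀ p → constant 1# *ₚ p ≈ₚ p
  *ₚ-identityˡ p n = begin
    coeff (scale 1# p +ₚ (0# ∷ [])) n           ≈⟨ coeff-+ (scale 1# p) (0# ∷ []) n ⟩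
    coeff (scale 1# p) n + coeff (0# ∷ []) n    ≈⟨ +-cong (trans (coeff-scale 1# p n) (*-identityˡ _)) (coeff-0 n) ⟩
    coeff p n + 0#                              ≈⟨ +-identityʳ _ ⟩
    coeff p n                                   ∎
    where
    coeff-0 : ∀ i → coeff (0# ∷ []) i ≈ 0#
    coeff-0 zero    = refl
    coeff-0 (suc i) = refl

  *ₚ-distribʳ : ∀ r p q → (p +ₚ q) *ₚ r ≈ₚ p *ₚ r +ₚ q *ₚ r
  *ₚ-distribʳ r p q n = begin
    coeff ((p +ₚ q) *ₚ r) n                           ≈⟨ coeff-* (p +ₚ q) r n ⟩
    conv (coeff (p +ₚ q)) (coeff r) n                 ≈⟨ conv-cong (coeff-+ p q) (λ i → refl) n ⟩
    conv (λ i → coeff p i + coeff q i) (coeff r) n    ≈⟨ conv-distribʳ (coeff p) (coeff q) (coeff r) n ⟩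
    conv (coeff p) (coeff r) n + conv (coeff q) (coeff r) n ≈⟨ +-cong (coeff-* p r n) (coeff-* q r n) ⟨
    coeff (p *ₚ r) n + coeff (q *ₚ r) n               ≈⟨ coeff-+ (p *ₚ r) (q *ₚ r) n ⟨
    coeff (p *ₚ r +ₚ q *ₚ r) n                        ∎

  +ₚ-cong : ∀ {p p′ q q′} → p ≈ₚ p′ → q ≈ₚ q′ → p +ₚ q ≈ₚ p′ +ₚ q′
  +ₚ-cong {p} {p′} {q} {q′} p≈p′ q≈q′ n = begin
    coeff (p +ₚ q) n        ≈⟨ coeff-+ p q n ⟩
    coeff p n + coeff q n   ≈⟨ +-cong (p≈p′ n) (q≈q′ n) ⟩
    coeff p′ n + coeff q′ n ≈⟨ coeff-+ p′ q′ n ⟨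
    coeff (p′ +ₚ q′) n      ∎

  +ₚ-comm : ∀ p q → p +ₚ q ≈ₚ q +ₚ p
  +ₚ-comm p q n = trans (coeff-+ p q n) (trans (+-comm _ _) (sym (coeff-+ q p n)))

  +ₚ-assoc : ∀ p q r → (p +ₚ q) +ₚ r ≈ₚ p +ₚ (q +ₚ r)
  +ₚ-assoc p q r n = begin
    coeff ((p +ₚ q) +ₚ r) n               ≈⟨ coeff-+ (p +ₚ q) r n ⟩
    coeff (p +ₚ q) n + coeff r n          ≈⟨ +-congʳ (coeff-+ p q n) ⟩
    coeff p n + coeff q n + coeff r n     ≈⟨ +-assoc _ _ _ ⟩
    coeff p n + (coeff q n + coeff r n)   ≈⟨ +-congˡ (coeff-+ q r n) ⟨
    coeff p n + coeff (q +ₚ r) n          ≈⟨ coeff-+ p (q +ₚ r) n ⟨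
    coeff (p +ₚ (q +ₚ r)) n               ∎

  +ₚ-inverseˡ : ∀ p → (-ₚ p) +ₚ p ≈ₚ []
  +ₚ-inverseˡ p n = trans (coeff-+ (-ₚ p) p n) (trans (+-congʳ (coeff-neg p n)) (-‿inverseˡ _))

  -ₚ-cong : ∀ {p q} → p ≈ₚ q → -ₚ p ≈ₚ -ₚ q
  -ₚ-cong {p} {q} p≈q n = trans (coeff-neg p n) (trans (-‿cong (p≈q n)) (sym (coeff-neg q n)))

  commutativeRing : CommutativeRing _ _
  commutativeRing = record
    { Carrier = Polynomial
    ; _≈_ = _≈ₚ_
    ; _+_ = _+ₚ_
    ; _*_ = _*ₚ_
    ; -_  = -ₚ_
    ; 0#  = []
    ; 1#  = constant 1#
    ; isCommutativeRing = record
      { isRing = record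
        { +-isAbelianGroup = record
          { isGroup = record
            { isMonoid = record
              { isSemigroup = record
                { isMagma = record
                  { isEquivalence = ≈ₚ-isEquivalence
                  ; ∙-cong = λ {p} {p′} {q} {q′} → +ₚ-cong {p} {p′} {q} {q′}
                  }
                ; assoc = +ₚ-assoc
                }
              ; identity = (λ p i → refl) , (λ p → +ₚ-comm p [])
              }
            ; inverse = (λ p → +ₚ-inverseˡ p) , (λ p n → trans (+ₚ-comm p (-ₚ p) n) (+ₚ-inverseˡ p n))
            ; ⁻¹-cong = λ {p} {q} → -ₚ-cong {p} {q}
            }
          ; comm = +ₚ-comm
          }
        ; *-cong = λ {p} {p′} {q} {q′} → *ₚ-cong {p} {p′} {q} {q′}
        ; *-assoc = *ₚ-assoc
        ; *-identity = *ₚ-identityˡ , (λ p n → trans (*ₚ-comm p (constant 1#) n) (*ₚ-identityˡ p n))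
        ; distrib = *ₚ-distribˡ , *ₚ-distribʳ
        }
      ; *-comm = *ₚ-comm
      }
    }
    where
    ≈ₚ-isEquivalence : IsEquivalence _≈ₚ_
    ≈ₚ-isEquivalence = record
      { refl  = λ i → refl
      ; sym   = λ p≈q i → sym (p≈q i)
      ; trans = λ p≈q q≈r i → trans (p≈q i) (q≈r i)
      }
    *ₚ-distribˡ : ∀ r p q → r *ₚ (p +ₚ q) ≈ₚ r *ₚ p +ₚ r *ₚ q
    *ₚ-distribˡ r p q n = begin
      coeff (r *ₚ (p +ₚ q)) n      ≈⟨ *ₚ-comm r (p +ₚ q) n ⟩
      coeff ((p +ₚ q) *ₚ r) n      ≈⟨ *ₚ-distribʳ r p q n ⟩
      coeff (p *ₚ r +ₚ q *ₚ r) n   ≈⟨ +ₚ-cong {p *ₚ r} {r *ₚ p} {q *ₚ r} {r *ₚ q} (*ₚ-comm p r) (*ₚ-comm q r) n ⟩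
      coeff (r *ₚ p +ₚ r *ₚ q) n   ∎

module MvPolynomial (R : CommutativeRing c ℓ) where
  open CommutativeRing R using (Carrier; _+_; _*_; 0#)

  -- R[x₀, …, xₙ₋₁] is built as R[x₁, …, xₙ₋₁][x₀].
  ring : ℕ → CommutativeRing c ℓ
  ring zero    = R
  ring (suc n) = PolynomialRing.commutativeRing (ring n)

  var : ∀ n → Vector (CommutativeRing.Carrier (ring n)) n
  var (suc n) zero    = CommutativeRing.0# (ring n) ∷ CommutativeRing.1# (ring n) ∷ []
  var (suc n) (suc i) = var n i ∷ []

  eval : ∀ {n} → Vector Carrier n → CommutativeRing.Carrier (ring n) → Carrier
  eval {zero}  x p = p
  eval {suc n} x p = List.foldr (λ a b → eval (tail x) a + head x * b) 0# p

module AlternantDivisibility (R : CommutativeRing c ℓ) where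
  open CommutativeRing R hiding (zero)
  open import Algebra.Properties.Ring ring
  open import Algebra.Properties.Semiring.Exp semiring using (_^_)
  open import Algebra.Properties.Semiring.Sum semiring
  open import Relation.Binary.Reasoning.Setoid setoid
  open import Algebra.Solver.Ring.NaturalCoefficients.Default commutativeSemiring
    using (solve; _:=_; _:+_; _:*_)
  open Determinant R
  open DeterminantProperties R
  open PolynomialRing R using (Polynomial; _+ₚ_; scale; -ₚ_)
  open Vandermonde R

  horner : Polynomial → Carrier → Carrier
  horner p t = List.foldr (λ a b → a + t * b) 0# p

  horner-+ : ∀ p q t → horner (p +ₚ q) t ≈ horner p t + horner q t
  horner-+ []      q       t = sym (+-identityˡ _)
  horner-+ (a ∷ p) []      t = sym (+-identityʳ _)
  horner-+ (a ∷ p) (b ∷ q) t = begin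
    a + b + t * horner (p +ₚ q) t             ≈⟨ +-congˡ (*-congˡ (horner-+ p q t)) ⟩
    a + b + t * (horner p t + horner q t)
      ≈⟨ solve 5 (λ a b t p q → a :+ b :+ t :* (p :+ q) := (a :+ t :* p) :+ (b :+ t :* q)) refl a b t _ _ ⟩
    (a + t * horner p t) + (b + t * horner q t) ∎

  horner-scale : ∀ d p t → horner (scale d p) t ≈ d * horner p t
  horner-scale d []      t = sym (zeroʳ d)
  horner-scale d (a ∷ p) t = begin
    d * a + t * horner (scale d p) t ≈⟨ +-congˡ (*-congˡ (horner-scale d p t)) ⟩
    d * a + t * (d * horner p t)     ≈⟨ solve 4 (λ d a t p → d :* a :+ t :* (d :* p) := d :* (a :+ t :* p)) refl d a t _ ⟩
    d * (a + t * horner p t)         ∎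

  horner-neg : ∀ p t → horner (-ₚ p) t ≈ - horner p t
  horner-neg []      t = sym -0#≈0#
  horner-neg (a ∷ p) t = begin
    - a + t * horner (-ₚ p) t ≈⟨ +-congˡ (*-congˡ (horner-neg p t)) ⟩
    - a + t * - horner p t    ≈⟨ +-congˡ (-‿distribʳ-* _ _) ⟨
    - a + - (t * horner p t)  ≈⟨ -‿+-comm _ _ ⟩
    - (a + t * horner p t)    ∎

  -- The divided difference (p(t) - p(y)) / (y - t) as a polynomial in t.
  quotient : Carrier → Polynomial → Polynomial
  quotient y []      = []
  quotient y (a ∷ p) = -ₚ p +ₚ scale y (quotient y p)

  horner-quotient : ∀ y t p → horner p t ≈ horner p y + (y - t) * horner (quotient y p) t
  horner-quotient y t []      = sym (trans (+-identityˡ _) (zeroʳ _))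
  horner-quotient y t (a ∷ p) = begin
    a + t * P
      ≈⟨ +-congˡ (begin
        t * P                                              ≈⟨ +-identityʳ _ ⟨
        t * P + 0#                                         ≈⟨ +-congˡ (-‿inverseʳ (y * P)) ⟨
        t * P + (y * P - y * P)                            ≈⟨ solve 3 (λ a b c → a :+ (b :+ c) := b :+ (a :+ c)) refl _ _ _ ⟩
        y * P + (t * P - y * P)                            ≈⟨ +-cong (*-congˡ (horner-quotient y t p)) (swap-sign t y P) ⟩
        y * (Y + (y - t) * Q) + (y - t) * - P              ≈⟨ solve 5 (λ y Y d Q P → y :* (Y :+ d :* Q) :+ d :* P := y :* Y :+ d :* (P :+ y :* Q)) refl y Y (y - t) Q (- P) ⟩
        y * Y + (y - t) * (- P + y * Q)                    ∎) ⟩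
    a + (y * Y + (y - t) * (- P + y * Q))
      ≈⟨ +-assoc _ _ _ ⟨
    a + y * Y + (y - t) * (- P + y * Q)
      ≈⟨ +-congˡ (*-congˡ (begin
        horner (-ₚ p +ₚ scale y (quotient y p)) t              ≈⟨ horner-+ (-ₚ p) _ t ⟩
        horner (-ₚ p) t + horner (scale y (quotient y p)) t    ≈⟨ +-cong (horner-neg p t) (horner-scale y (quotient y p) t) ⟩
        - P + y * Q                                            ∎)) ⟨
    a + y * Y + (y - t) * horner (quotient y (a ∷ p)) t ∎
    where
    P Y Q : Carrier
    P = horner p t
    Y = horner p y
    Q = horner (quotient y p) t

    swap-sign : ∀ t y P → t * P - y * P ≈ (y - t) * - P
    swap-sign t y P = begin
      t * P - y * P            ≈⟨ +-congʳ (-‿involutive _) ⟨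
      - - (t * P) - y * P      ≈⟨ -‿+-comm _ _ ⟩
      - (- (t * P) + y * P)    ≈⟨ -‿cong (+-congʳ (-‿distribˡ-* _ _)) ⟩
      - (- t * P + y * P)      ≈⟨ -‿cong (distribʳ _ _ _) ⟨
      - ((- t + y) * P)        ≈⟨ -‿cong (*-congʳ (+-comm _ _)) ⟩
      - ((y - t) * P)          ≈⟨ -‿distribʳ-* _ _ ⟩
      (y - t) * - P            ∎

  divisible : ∀ {n} (x : Vector Carrier n) (g : Vector Polynomial n) →
              Σ[ q ∈ Carrier ] q * Δ x ≈ det (λ i j → horner (g j) (x i))
  divisible {zero}  x g = 1# , *-identityˡ 1#
  divisible {suc n} x g = sum term , (begin
    sum term * (d * Δ (tail x))
      ≈⟨ solve 3 (λ s d v → s :* (d :* v) := d :* (s :* v)) refl (sum term) d (Δ (tail x)) ⟩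
    d * (sum term * Δ (tail x))
      ≈⟨ *-congˡ (*-distribʳ-sum (Δ (tail x)) term) ⟩
    d * sum (λ j → term j * Δ (tail x))
      ≈⟨ *-congˡ (sum-cong-≋ λ j → begin
        (s j * (r j * proj₁ (ih j))) * Δ (tail x) ≈⟨ solve 4 (λ s r q v → (s :* (r :* q)) :* v := s :* (r :* (q :* v))) refl (s j) (r j) (proj₁ (ih j)) (Δ (tail x)) ⟩
        s j * (r j * (proj₁ (ih j) * Δ (tail x))) ≈⟨ *-congˡ (*-congˡ (proj₂ (ih j))) ⟩
        s j * (r j * det (minor M j)) ∎) ⟩
    d * det M
      ≈⟨ det-scaleRows r (λ i → head x - tail x i) (tail M) ⟨
    det (r Vector.∷ λ i j → r j + (head x - tail x i) * tail M i j)
      ≈⟨ det-cong {A = r Vector.∷ λ i j → r j + (head x - tail x i) * tail M i j} {B = λ i j → horner (g j) (x i)}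
           (λ { zero j → refl ; (suc i) j → sym (horner-quotient (head x) (tail x i) (g j)) }) ⟩
    det (λ i j → horner (g j) (x i)) ∎)
    where
    s : Fin (suc n) → Carrier
    s j = (- 1#) ^ toℕ j

    r : Vector Carrier (suc n)
    r j = horner (g j) (head x)

    h : Vector Polynomial (suc n)
    h j = quotient (head x) (g j)

    M : Matrix (suc n)
    M = r Vector.∷ λ i j → horner (h j) (tail x i)

    d : Carrier
    d = product (λ i → head x - tail x i)

    ih : ∀ j → Σ[ q ∈ Carrier ] q * Δ (tail x) ≈ det (minor M j)
    ih j = divisible (tail x) (λ k → h (punchIn j k))

    term : Vector Carrier (suc n)
    term j = s j * (r j * proj₁ (ih j))

  monomial : ℕ → Polynomial
  monomial zero    = 1# ∷ []
  monomial (suc e) = 0# ∷ monomial e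

  horner-monomial : ∀ e t → horner (monomial e) t ≈ t ^ e
  horner-monomial zero    t = trans (+-congˡ (zeroʳ t)) (+-identityʳ 1#)
  horner-monomial (suc e) t = trans (+-identityˡ _) (*-congˡ (horner-monomial e t))

  alternant-divisible : ∀ {n} (x : Vector Carrier n) (e : Vector ℕ n) →
                        Σ[ q ∈ Carrier ] q * Δ x ≈ det (λ i j → x i ^ e j)
  alternant-divisible x e with q , q*Δ≈ ← divisible x (monomial ∘ e) =
    q , trans q*Δ≈ (det-cong λ i j → horner-monomial (e j) (x i))

-- Partitions are represented without trailing zeros.
record Partition : Set where
  constructor mkPartition
  field
    parts         : List ℕ
    nonincreasing : Linked _≥_ parts
    positive      : All (0 <_) parts

  length : ℕ
  length = List.length parts

open Partition using (parts; length)

nth : List ℕ → ℕ → ℕ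
nth []       i       = 0
nth (x ∷ xs) zero    = x
nth (x ∷ xs) (suc i) = nth xs i

-- Pads with zeros; it only makes sense for length μ ≤ n.
pad : ∀ n → Partition → Vector ℕ n
pad n μ i = nth (parts μ) (toℕ i)

ρ : ∀ n → Vector ℕ n
ρ n i = n ∸ suc (toℕ i)

infixl 6 _⊹_

_⊹_ : ∀ {n} → Vector ℕ n → Vector ℕ n → Vector ℕ n
_⊹_ = Vector.zipWith ℕ._+_

-- A witness contains the permutation sorting (μ + ρₘ) ∪ (ν + ρₙ) into κ + ρₘ₊ₙ;
-- it is unique, as the entries of the latter are distinct.
IsOverlap : ∀ m n → Partition → Partition → Partition → Set
IsOverlap m n μ ν κ =
  length κ ≤ m ℕ.+ n × (pad m μ ⊹ ρ m) ++ (pad n ν ⊹ ρ n) ↭ pad (m ℕ.+ n) κ ⊹ ρ (m ℕ.+ n)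

-- (-1) to the number of inversions.
sgn : ∀ {m n} → Permutation m n → Sign
sgn π = pairs λ i j → if does (π ⟨$⟩ʳ j Fin.<? π ⟨$⟩ʳ i) then Sign.- else Sign.+
  where open PairProduct Sign.*-commutativeMonoid

record Enumeration {A : Set a} (P : Pred A p) : Set (a ⊔ p) where
  field
    elements : List A
    unique   : Unique elements
    sound    : All P elements
    complete : ∀ {x} → P x → x ∈ elements

partition-≡ : ∀ {μ ν} → parts μ ≡ parts ν → μ ≡ ν
partition-≡ {mkPartition xs ≥₁ >₁} {mkPartition .xs ≥₂ >₂} ≡.refl =
  ≡.cong₂ (mkPartition xs) (Linked.irrelevant ℕ.≤-irrelevant ≥₁ ≥₂) (All.irrelevant ℕ.<-irrelevant >₁ >₂)

_≟-Partition_ : DecidableEquality Partition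
μ ≟-Partition ν = map′ partition-≡ (≡.cong parts) (List.≡-dec ℕ._≟_ (parts μ) (parts ν))

isPartition? : ∀ xs → Dec (Linked _≥_ xs × All (0 <_) xs)
isPartition? xs = Linked.linked? _≥?_ xs ×-dec All.all? (0 <?_) xs

collect : List (List ℕ) → List Partition
collect []         = []
collect (xs ∷ xss) with isPartition? xs
... | yes (≥-xs , >-xs) = mkPartition xs ≥-xs >-xs ∷ collect xss
... | no  _             = collect xss

collect-complete : ∀ {μ} xss → parts μ ∈ xss → μ ∈ collect xss
collect-complete {μ} (xs ∷ xss) ∈xss with isPartition? xs | ∈xss
... | yes _ | here px = here (partition-≡ px)
... | yes _ | there i = there (collect-complete xss i)
... | no ¬p | here ≡.refl = contradiction (Partition.nonincreasing μ , Partition.positive μ) ¬p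
... | no _  | there i = collect-complete xss i

collect-unique : ∀ {xss} → Unique xss → Unique (collect xss)
collect-unique {[]} [] = []
collect-unique {xs ∷ xss} (∉ ∷ u) with isPartition? xs
... | yes _ = collect-all ∉ ∷ collect-unique u
  where
  collect-all : ∀ {≥-xs >-xs yss} → All (λ ys → ¬ xs ≡ ys) yss → All (λ ν → ¬ mkPartition xs ≥-xs >-xs ≡ ν) (collect yss)
  collect-all {yss = []} [] = []
  collect-all {yss = ys ∷ yss} (q ∷ qs) with isPartition? ys
  ... | yes _ = (λ { ≡.refl → q ≡.refl }) ∷ collect-all qs
  ... | no  _ = collect-all qs
... | no  _ = collect-unique u

sequences : ℕ → ℕ → List (List ℕ)
sequences zero    B = [] ∷ []
sequences (suc n) B = [] ∷ cartesianProductWith _∷_ (upTo (suc B)) (sequences n B)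

sequences-unique : ∀ n B → Unique (sequences n B)
sequences-unique zero    B = [] ∷ []
sequences-unique (suc n) B =
  All.cartesianProductWith⁺ (≡.setoid ℕ) (≡.setoid (List ℕ)) _∷_ (upTo (suc B)) (sequences n B) (λ _ _ ())
  ∷ Unique.cartesianProductWith⁺ _∷_ List.∷-injective (Unique.upTo⁺ (suc B)) (sequences-unique n B)

sequences-complete : ∀ n B xs → List.length xs ≤ n → (∀ (i : Fin n) → nth xs (toℕ i) ≤ B) → xs ∈ sequences n B
sequences-complete zero    B []       _ _  = here ≡.refl
sequences-complete (suc n) B []       _ _  = here ≡.refl
sequences-complete (suc n) B (x ∷ xs) (s≤s l≤n) ≤B = there
  (∈-cartesianProductWith⁺ _∷_ (∈-upTo⁺ (s≤s (≤B zero))) (sequences-complete n B xs l≤n (≤B ∘ suc)))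

partitions : ℕ → ℕ → List Partition
partitions n B = collect (sequences n B)

partitions-complete : ∀ n B μ → length μ ≤ n → (∀ i → pad n μ i ≤ B) → μ ∈ partitions n B
partitions-complete n B μ l≤n ≤B = collect-complete (sequences n B) (sequences-complete n B (parts μ) l≤n ≤B)

total : ∀ {n} → Vector ℕ n → ℕ
total = Vector.foldr ℕ._+_ 0

lookup≤total : ∀ {n} (xs : Vector ℕ n) i → xs i ≤ total xs
lookup≤total xs zero    = m≤m+n _ _
lookup≤total xs (suc i) = ≤-trans (lookup≤total (tail xs) i) (m≤n+m _ _)

_↭?_ : ∀ {m n} (xs : Vector ℕ m) (ys : Vector ℕ n) → Dec (xs ↭ ys)
_↭?_ {zero}  {zero}  xs ys = yes (Perm.id , λ ())
_↭?_ {zero}  {suc n} xs ys = no λ (π , _) → contradiction π (Perm.refute λ ())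
_↭?_ {suc m} {zero}  xs ys = no λ (π , _) → contradiction π (Perm.refute λ ())
_↭?_ {suc m} {suc n} xs ys with Fin.any? (λ i → xs i ℕ.≟ ys zero)
... | no  ∄i = no λ (π , eq) → ∄i (π ⟨$⟩ʳ zero , eq zero)
... | yes (i , xsᵢ≡ys₀) = map′ extend restrict (removeAt xs i ↭? tail ys)
  where
  extend : removeAt xs i ↭ tail ys → xs ↭ ys
  extend (π , eq) = Perm.insert zero i π , λ
    { zero    → xsᵢ≡ys₀
    ; (suc j) → ≡.trans (≡.cong xs (Perm.insert-punchIn zero i π j)) (eq j) }

  restrict : xs ↭ ys → removeAt xs i ↭ tail ys
  restrict (π , eq) = ≡.subst (λ k → removeAt xs k ↭ tail ys) π′0≡i (Perm.remove zero π′ , λ j →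
    ≡.trans (≡.cong xs (≡.sym (Perm.punchIn-permute π′ zero j))) (≡.trans (xs-swap (π ⟨$⟩ʳ suc j)) (eq (suc j))))
    where
    π′ : Permutation (suc n) (suc m)
    π′ = π Perm.∘ₚ Perm.transpose (π ⟨$⟩ʳ zero) i

    π′0≡i : π′ ⟨$⟩ʳ zero ≡ i
    π′0≡i with (π ⟨$⟩ʳ zero) Fin.≟ (π ⟨$⟩ʳ zero)
    ... | yes _ = ≡.refl
    ... | no ≢  = contradiction ≡.refl ≢

    xs-swap : ∀ k → xs (PC.transpose (π ⟨$⟩ʳ zero) i k) ≡ xs k
    xs-swap k with k Fin.≟ π ⟨$⟩ʳ zero
    ... | yes ≡.refl = ≡.trans xsᵢ≡ys₀ (≡.sym (eq zero))
    ... | no  _ with k Fin.≟ i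
    ...   | yes ≡.refl = ≡.trans (eq zero) (≡.sym xsᵢ≡ys₀)
    ...   | no  _    = ≡.refl

↭-bound : ∀ {m n} {xs : Vector ℕ m} {ys : Vector ℕ n} → xs ↭ ys → ∀ i → ys i ≤ total xs
↭-bound {xs = xs} (π , eq) i = ≡.subst (_≤ total xs) (eq i) (lookup≤total xs (π ⟨$⟩ʳ i))

↭-sym : ∀ {m n} {xs : Vector ℕ m} {ys : Vector ℕ n} → xs ↭ ys → ys ↭ xs
↭-sym {xs = xs} (π , eq) = Perm.flip π , λ i → ≡.trans (≡.sym (eq (π ⟨$⟩ˡ i))) (≡.cong xs (Perm.inverseʳ π))

overlap? : ∀ m n μ ν → Dec (∃[ κ ] IsOverlap m n μ ν κ)
overlap? m n μ ν = map′
  (λ κ∈ → let κ , _ , o = find κ∈ in κ , o)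
  (λ (κ , o) → lose (partitions-complete (m ℕ.+ n) (total ks) κ (proj₁ o) λ i → ≤-trans (m≤m+n _ _) (↭-bound (proj₂ o) i)) o)
  (any? (λ κ → (length κ ≤? m ℕ.+ n) ×-dec (ks ↭? (pad (m ℕ.+ n) κ ⊹ ρ (m ℕ.+ n)))) (partitions (m ℕ.+ n) (total ks)))
  where
  ks = (pad m μ ⊹ ρ m) ++ (pad n ν ⊹ ρ n)

-- nothing stands for ∞. The partition found is the only possible one, since κ + ρₘ₊ₙ
-- is strictly decreasing.
_⋆[_,_]_ : Partition → ℕ → ℕ → Partition → Maybe Partition
μ ⋆[ m , n ] ν with overlap? m n μ ν
... | yes (κ , _) = just κ
... | no  _       = nothing

ε : ∀ m n → Partition → Partition → Sign
ε m n μ ν with overlap? m n μ ν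
... | yes (_ , _ , π , _) = sgn π
... | no  _               = Sign.+

⋆-sound : ∀ {m n μ ν κ} → μ ⋆[ m , n ] ν ≡ just κ → IsOverlap m n μ ν κ
⋆-sound {m} {n} {μ} {ν} eq with overlap? m n μ ν
⋆-sound ≡.refl | yes (_ , o) = o

OverlapsTo : ∀ m n → Partition → Pred (Partition × Partition) _
OverlapsTo m n κ (μ , ν) = length μ ≤ m × length ν ≤ n × μ ⋆[ m , n ] ν ≡ just κ

overlapPairs : ∀ m n κ → Enumeration (OverlapsTo m n κ)
overlapPairs m n κ = record
  { elements = filter overlaps? candidates
  ; unique   = Unique.filter⁺ overlaps? (Unique.cartesianProduct⁺
                 (collect-unique (sequences-unique m B)) (collect-unique (sequences-unique n B)))
  ; sound    = All.all-filter overlaps? candidates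
  ; complete = λ { {μ , ν} o@(lμ , lν , eq) → ∈-filter⁺ overlaps?
      (∈-cartesianProduct⁺
        (partitions-complete m B μ lμ λ i → ≤-trans (m≤m+n _ _)
          (≡.subst (_≤ B) (lookup-++ˡ (pad m μ ⊹ ρ m) (pad n ν ⊹ ρ n) i) (bound eq (i ↑ˡ n))))
        (partitions-complete n B ν lν λ i → ≤-trans (m≤m+n _ _)
          (≡.subst (_≤ B) (lookup-++ʳ (pad m μ ⊹ ρ m) (pad n ν ⊹ ρ n) i) (bound eq (m ↑ʳ i)))))
      o }
  }
  where
  B : ℕ
  B = total (pad (m ℕ.+ n) κ ⊹ ρ (m ℕ.+ n))

  candidates : List (Partition × Partition)
  candidates = cartesianProduct (partitions m B) (partitions n B)

  overlaps? : ∀ μν → Dec (OverlapsTo m n κ μν)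
  overlaps? (μ , ν) = (length μ ≤? m) ×-dec (length ν ≤? n) ×-dec Maybe.≡-dec _≟-Partition_ (μ ⋆[ m , n ] ν) (just κ)

  bound : ∀ {μ ν} → μ ⋆[ m , n ] ν ≡ just κ → ∀ i → ((pad m μ ⊹ ρ m) ++ (pad n ν ⊹ ρ n)) i ≤ B
  bound {μ} {ν} eq = ↭-bound (↭-sym (proj₂ (⋆-sound {m} {n} {μ} {ν} eq)))

module Schur (R : CommutativeRing c ℓ) where
  open CommutativeRing R using (Carrier; 0#)
  open MvPolynomial R

  module _ (n : ℕ) (κ : Partition) where
    open CommutativeRing (ring n) using (_*_; _≈_; semiring) renaming (Carrier to Poly)
    open import Algebra.Properties.Semiring.Exp semiring using (_^_)
    open Vandermonde (ring n) using (Δ)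
    open Determinant (ring n) using (det)

    alternant : Poly
    alternant = det λ i j → var n i ^ (pad n κ ⊹ ρ n) j

    -- Determined up to ≈: each var i - var j with i ≠ j is a non-zero-divisor.
    -- Evaluating poly extends det/Δ to points with repeated coordinates.
    record SchurPolynomial : Set (c ⊔ ℓ) where
      field
        poly             : Poly
        poly*Δ≈alternant : poly * Δ (var n) ≈ alternant

    schurPolynomial : SchurPolynomial
    schurPolynomial with q , q*Δ≈ ← AlternantDivisibility.alternant-divisible (ring n) (var n) (pad n κ ⊹ ρ n) =
      record { poly = q ; poly*Δ≈alternant = q*Δ≈ }

  schur : ∀ {n} → Partition → Vector Carrier n → Carrier
  schur {n} κ x =
    if does (length κ ≤? n) then eval x (SchurPolynomial.poly (schurPolynomial n κ)) else 0#

module FieldNotation (F : HeytingField c ℓ₁ ℓ₂) where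
  open HeytingField F public using (Carrier; _≈_; _#_; _+_; _*_; -_; 0#; 1#; #⇒invertible; heytingCommutativeRing)
  open HeytingCommutativeRing heytingCommutativeRing using (commutativeRing)
  open Vandermonde commutativeRing public using (Δ[_⨾_])
  open Schur commutativeRing public using (schur)

  infixl 7 _/_

  -- #⇒invertible provides an inverse of y - 0#, that is, of y.
  _/_ : (x y : Carrier) → y # 0# → Carrier
  (x / y) y#0 = x * proj₁ (#⇒invertible y#0)

  signed : Sign → Carrier
  signed Sign.+ = 1#
  signed Sign.- = - 1#

  ∑ : ∀ {A : Set a} {P : Pred A p} → Enumeration P → (A → Carrier) → Carrier
  ∑ I f = List.foldr (λ x s → f x + s) 0# (Enumeration.elements I)

module Submission where

-- Write d = det(xᵉ) for the alternant of 𝒮 ∪ 𝒯 with exponents e = λ + ρ. Laplace expansion along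
-- the rows of 𝒮 writes d as a signed sum, over all ways of dividing e into a part of size m and a
-- part of size n, of products of an alternant of 𝒮 and an alternant of 𝒯. The two parts are
-- decreasing, so they are μ + ρ and ν + ρ for partitions μ, ν, and the divisions of e correspond
-- to the pairs with overlap λ. Since Δ(𝒮 ∪ 𝒯) = Δ(𝒮; 𝒯) Δ(𝒮) Δ(𝒯), cancelling Δ(𝒮) Δ(𝒯) gives the
-- result. This cancellation is legitimate for indeterminates; arbitrary points, where Δ(𝒮) or Δ(𝒯)
-- may vanish, are reached by evaluating the resulting polynomial identity.

open import Algebra.Apartness.Bundles using (HeytingCommutativeRing; HeytingField)
open import Algebra.Bundles using (CommutativeMonoid; CommutativeRing)
open import Algebra.Morphism.Structures using (module RingMorphisms)
open import Data.Bool.Base using (if_then_else_)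
open import Data.Fin.Base as Fin using (Fin; zero; suc; toℕ; punchIn; _↑ˡ_; _↑ʳ_; splitAt; join)
open import Data.Fin.Permutation as Perm using (Permutation; _⟨$⟩ʳ_; _⟨$⟩ˡ_)
import Data.Fin.Properties as Fin
open import Data.List.Base as List using (List; []; _∷_; map; foldr; filter; tabulate)
open import Data.List.Membership.Propositional using (_∈_)
open import Data.List.Membership.Propositional.Properties using (∈-++⁺ˡ; ∈-++⁺ʳ; ∈-++⁻; ∈-map⁺; ∈-map⁻; ∈-filter⁺; ∈-filter⁻; ∈-tabulate⁺; ∈-tabulate⁻)
open import Data.List.Membership.Propositional.Properties.WithK using (unique∧set⇒bag)
import Data.List.Properties as List
open import Data.List.Relation.Binary.BagAndSetEquality using (∼bag⇒↭)
open import Data.List.Relation.Binary.Disjoint.Propositional using (Disjoint)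
open import Data.List.Relation.Binary.Permutation.Propositional as List↭ using () renaming (_↭_ to _↭ˡ_)
open import Data.List.Relation.Binary.Pointwise using (Pointwise; []; _∷_)
open import Data.List.Relation.Unary.All as All using (All; []; _∷_)
import Data.List.Relation.Unary.All.Properties as All
open import Data.List.Relation.Unary.AllPairs as AllPairs using (AllPairs; []; _∷_)
open import Data.List.Relation.Unary.Any using (here; there)
open import Data.List.Relation.Unary.Linked.Properties using (AllPairs⇒Linked; Linked⇒AllPairs)
open import Data.List.Relation.Unary.Unique.Propositional using (Unique)
import Data.List.Relation.Unary.Unique.Propositional.Properties as Unique
open import Data.Maybe.Base using (just)
open import Data.Nat.Base as ℕ using (ℕ; zero; suc; _∸_; _≤_; _<_; _>_; _≥_; z≤n; s≤s)
import Data.Nat.Properties as ℕ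
open import Data.Product.Base using (_×_; _,_; proj₁; proj₂; Σ-syntax; ∃-syntax)
open import Data.Sign.Base as Sign using (Sign)
import Data.Sign.Properties as Sign
open import Data.Sum.Base as Sum using (_⊎_; inj₁; inj₂; [_,_]′)
import Data.Sum.Properties as Sum
open import Data.Vec.Functional using (Vector; head; tail; removeAt; _++_)
open import Data.Vec.Functional.Properties using (lookup-++ˡ; lookup-++ʳ)
open import Defs
open import Function.Base using (_∘_)
open import Function.Bundles using (mk⇔)
open import Level using (Level; _⊔_)
open import Relation.Binary.Core using (Rel)
open import Relation.Binary.PropositionalEquality as ≡ using (_≡_)
open import Relation.Nullary.Decidable using (yes; no; does; dec-true; dec-false)
open import Relation.Nullary.Negation using (¬_; contradiction)
open import Relation.Unary using (Pred; Decidable)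
open Partition using (parts; length)

-- The delicate point is the passage to arbitrary points. The three Schur functions come from
-- polynomials in three different rings, in m + n, m and n variables, while the cancellation takes
-- place in m + n variables. A Heyting field also does not decide whether two coordinates coincide,
-- so there is no splitting into generic and degenerate points. What ties the rings together is
-- stronger than uniqueness of det / Δ: the quotient is produced by cofactor expansion and divided
-- differences, that is, by ring operations that never inspect a coefficient. Every ring
-- homomorphism respects this recipe, so a Schur polynomial evaluated at a point equals the recipe
-- run at that point (`quotientSchur`), whichever ring it came from.
--
-- The cancellation itself assumes no integral domain: Δ of the indeterminates is a non-zero-divisor
-- over every commutative ring.
--
-- The signs have different origins. The Laplace sign is built recursively, whereas `ε` counts the
-- inversions of a permutation found by search. They agree because the entries of an overlap are
-- distinct, so only one permutation sorts them.

private
  variable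
    a b c c′ ℓ ℓ′ p x : Level
    A : Set a
    B : Set b
    X : Set x

-- Laplace expansion

parity : List X → Sign
parity []       = Sign.+
parity (_ ∷ xs) = Sign.- Sign.* parity xs

takeˡ takeʳ : X → Sign × List X × List X → Sign × List X × List X
takeˡ x (σ , as , bs) = σ , x ∷ as , bs
takeʳ x (σ , as , bs) = parity as Sign.* σ , as , x ∷ bs

-- The sign is that of the permutation taking the list to the concatenation of the two parts:
-- an element that goes to the right part moves past all of the left part.
splits : List X → List (Sign × List X × List X)
splits []       = (Sign.+ , [] , []) ∷ []
splits (x ∷ xs) = map (takeˡ x) (splits xs) List.++ map (takeʳ x) (splits xs)

module ListSum (R : CommutativeRing c ℓ) where
  open CommutativeRing R hiding (zero)
  open import Algebra.Properties.Ring ring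
  open import Algebra.Solver.Ring.NaturalCoefficients.Default commutativeSemiring
    using (solve; _:=_; _:+_; _:*_)
  open import Relation.Binary.Reasoning.Setoid setoid

  listSum : (A → Carrier) → List A → Carrier
  listSum f = foldr (λ x s → f x + s) 0#

  listSum-cong : ∀ {f g : A → Carrier} xs → (∀ {x} → x ∈ xs → f x ≈ g x) → listSum f xs ≈ listSum g xs
  listSum-cong []       f≈g = refl
  listSum-cong (x ∷ xs) f≈g = +-cong (f≈g (here ≡.refl)) (listSum-cong xs (f≈g ∘ there))

  listSum-++ : ∀ (f : A → Carrier) xs ys → listSum f (xs List.++ ys) ≈ listSum f xs + listSum f ys
  listSum-++ f []       ys = sym (+-identityˡ _)
  listSum-++ f (x ∷ xs) ys = trans (+-congˡ (listSum-++ f xs ys)) (sym (+-assoc _ _ _))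

  listSum-map : ∀ (f : B → Carrier) (g : A → B) xs → listSum f (map g xs) ≈ listSum (f ∘ g) xs
  listSum-map f g []       = refl
  listSum-map f g (x ∷ xs) = +-congˡ (listSum-map f g xs)

  listSum-0 : ∀ (xs : List A) → listSum (λ _ → 0#) xs ≈ 0#
  listSum-0 []       = refl
  listSum-0 (x ∷ xs) = trans (+-identityˡ _) (listSum-0 xs)

  listSum-+ : ∀ (f g : A → Carrier) xs → listSum (λ x → f x + g x) xs ≈ listSum f xs + listSum g xs
  listSum-+ f g []       = sym (+-identityˡ 0#)
  listSum-+ f g (x ∷ xs) = trans (+-congˡ (listSum-+ f g xs))
    (solve 4 (λ a b c d → (a :+ b) :+ (c :+ d) := (a :+ c) :+ (b :+ d)) refl _ _ _ _)

  listSum-*ˡ : ∀ r (f : A → Carrier) xs → listSum (λ x → r * f x) xs ≈ r * listSum f xs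
  listSum-*ˡ r f []       = sym (zeroʳ r)
  listSum-*ˡ r f (x ∷ xs) = trans (+-congˡ (listSum-*ˡ r f xs)) (sym (distribˡ _ _ _))

  listSum-*ʳ : ∀ r (f : A → Carrier) xs → listSum (λ x → f x * r) xs ≈ listSum f xs * r
  listSum-*ʳ r f []       = sym (zeroˡ r)
  listSum-*ʳ r f (x ∷ xs) = trans (+-congˡ (listSum-*ʳ r f xs)) (sym (distribʳ _ _ _))

  listSum-↭ : ∀ (f : A → Carrier) {xs ys} → xs ↭ˡ ys → listSum f xs ≈ listSum f ys
  listSum-↭ f List↭.refl         = refl
  listSum-↭ f (List↭.prep x p)   = +-congˡ (listSum-↭ f p)
  listSum-↭ f (List↭.swap x y p) = trans (+-congˡ (+-congˡ (listSum-↭ f p)))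
    (solve 3 (λ a b s → a :+ (b :+ s) := b :+ (a :+ s)) refl _ _ _)
  listSum-↭ f (List↭.trans p q)  = trans (listSum-↭ f p) (listSum-↭ f q)

  listSum-filter : ∀ {P : Pred A p} (P? : Decidable P) (f : A → Carrier) xs →
                   (∀ x → ¬ P x → f x ≈ 0#) → listSum f (filter P? xs) ≈ listSum f xs
  listSum-filter P? f []       f≈0 = refl
  listSum-filter P? f (x ∷ xs) f≈0 with P? x
  ... | yes _  = +-congˡ (listSum-filter P? f xs f≈0)
  ... | no ¬px = trans (listSum-filter P? f xs f≈0) (sym (trans (+-congʳ (f≈0 x ¬px)) (+-identityˡ _)))

  signed : Sign → Carrier
  signed Sign.+ = 1#
  signed Sign.- = - 1#

  signed-* : ∀ σ τ → signed (σ Sign.* τ) ≈ signed σ * signed τ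
  signed-* Sign.+ τ      = sym (*-identityˡ _)
  signed-* Sign.- Sign.+ = sym (*-identityʳ _)
  signed-* Sign.- Sign.- = sym (trans (-1*x≈-x _) (-‿involutive 1#))

-- Rows and columns are lists of labels, so that a minor is a determinant on sublists and needs no
-- index arithmetic. For an alternant the column labels are the exponents, and dividing the columns
-- is dividing the entries of `κ + ρ`.
module Laplace (R : CommutativeRing c ℓ) {A : Set a} {X : Set x} (entry : A → X → CommutativeRing.Carrier R) where
  open CommutativeRing R hiding (zero)
  open import Algebra.Properties.Ring ring
  open import Algebra.Properties.Semiring.Sum semiring using (sum; sum-cong-≋; *-distribˡ-sum)
  open import Algebra.Solver.Ring.NaturalCoefficients.Default commutativeSemiring
    using (solve; _:=_; _:+_; _:*_)
  open import Relation.Binary.Reasoning.Setoid setoid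
  open Determinant R
  open DeterminantProperties R using (sg)
  open ListSum R

  -- Cofactor expansion along a row: the nested subtractions produce the signs `(-1)^j`, and `F`
  -- receives the chosen column with the remaining ones in order.
  pickSum : List X → (X → List X → Carrier) → Carrier
  pickSum []       F = 0#
  pickSum (x ∷ xs) F = F x xs - pickSum xs (λ y ys → F y (x ∷ ys))

  splitSum : List X → (List X → List X → Carrier) → Carrier
  splitSum xs G = listSum (λ (σ , as , bs) → signed σ * G as bs) (splits xs)

  -- The length equation handed to the hypothesis is what relates the parity or the size of the
  -- remaining columns to that of `xs`.
  pickSum-cong : ∀ xs {F G} → (∀ y ys → List.length xs ≡ suc (List.length ys) → F y ys ≈ G y ys) → pickSum xs F ≈ pickSum xs G
  pickSum-cong []       F≈G = refl
  pickSum-cong (x ∷ xs) F≈G = +-cong (F≈G x xs ≡.refl)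
    (-‿cong (pickSum-cong xs λ y ys eq → F≈G y (x ∷ ys) (≡.cong suc eq)))

  pickSum-+ : ∀ xs F G → pickSum xs (λ y ys → F y ys + G y ys) ≈ pickSum xs F + pickSum xs G
  pickSum-+ []       F G = sym (+-identityˡ 0#)
  pickSum-+ (x ∷ xs) F G = begin
    F x xs + G x xs - pickSum xs (λ y ys → F y (x ∷ ys) + G y (x ∷ ys))
      ≈⟨ +-congˡ (trans (-‿cong (pickSum-+ xs _ _)) (sym (-‿+-comm _ _))) ⟩
    F x xs + G x xs + (- pickSum xs (λ y ys → F y (x ∷ ys)) + - pickSum xs (λ y ys → G y (x ∷ ys)))
      ≈⟨ solve 4 (λ a b c d → (a :+ b) :+ (c :+ d) := (a :+ c) :+ (b :+ d)) refl _ _ _ _ ⟩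
    pickSum (x ∷ xs) F + pickSum (x ∷ xs) G ∎

  pickSum-*ˡ : ∀ r xs F → pickSum xs (λ y ys → r * F y ys) ≈ r * pickSum xs F
  pickSum-*ˡ r []       F = sym (zeroʳ r)
  pickSum-*ˡ r (x ∷ xs) F = begin
    r * F x xs - pickSum xs (λ y ys → r * F y (x ∷ ys))
      ≈⟨ +-congˡ (trans (-‿cong (pickSum-*ˡ r xs _)) (-‿distribʳ-* _ _)) ⟩
    r * F x xs + r * - pickSum xs (λ y ys → F y (x ∷ ys))
      ≈⟨ distribˡ _ _ _ ⟨
    r * pickSum (x ∷ xs) F ∎

  pickSum-*ʳ : ∀ r xs F → pickSum xs (λ y ys → F y ys * r) ≈ pickSum xs F * r
  pickSum-*ʳ r xs F = trans (pickSum-cong xs λ _ _ _ → *-comm _ _) (trans (pickSum-*ˡ r xs F) (*-comm _ _))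

  splitSum-cong : ∀ xs {F G} → (∀ as bs → F as bs ≈ G as bs) → splitSum xs F ≈ splitSum xs G
  splitSum-cong xs F≈G = listSum-cong (splits xs) λ _ → *-congˡ (F≈G _ _)

  splitSum-+ : ∀ xs F G → splitSum xs (λ as bs → F as bs + G as bs) ≈ splitSum xs F + splitSum xs G
  splitSum-+ xs F G = trans (listSum-cong (splits xs) λ _ → distribˡ _ _ _) (listSum-+ _ _ (splits xs))

  splitSum-*ˡ : ∀ r xs F → splitSum xs (λ as bs → r * F as bs) ≈ r * splitSum xs F
  splitSum-*ˡ r xs F = trans
    (listSum-cong (splits xs) λ _ → solve 3 (λ s r f → s :* (r :* f) := r :* (s :* f)) refl _ _ _)
    (listSum-*ˡ r _ (splits xs))

  splitSum-neg : ∀ xs F → splitSum xs (λ as bs → - F as bs) ≈ - splitSum xs F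
  splitSum-neg xs F = begin
    splitSum xs (λ as bs → - F as bs)      ≈⟨ splitSum-cong xs (λ _ _ → sym (-1*x≈-x _)) ⟩
    splitSum xs (λ as bs → - 1# * F as bs) ≈⟨ splitSum-*ˡ (- 1#) xs F ⟩
    - 1# * splitSum xs F                   ≈⟨ -1*x≈-x _ ⟩
    - splitSum xs F                        ∎

  splitSum-∷ : ∀ x xs G → splitSum (x ∷ xs) G ≈
               splitSum xs (λ as bs → G (x ∷ as) bs) + splitSum xs (λ as bs → signed (parity as) * G as (x ∷ bs))
  splitSum-∷ x xs G = trans (listSum-++ _ (map (takeˡ x) (splits xs)) (map (takeʳ x) (splits xs)))
    (+-cong (listSum-map _ (takeˡ x) (splits xs))
      (trans (listSum-map _ (takeʳ x) (splits xs)) (listSum-cong (splits xs) λ { {σ , as , bs} _ →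
        trans (*-congʳ (signed-* (parity as) σ)) (solve 3 (λ p s g → p :* s :* g := s :* (p :* g)) refl _ _ _) })))

  -- What remains after picking is one element shorter than `xs`, so its parity is the opposite
  -- sign.
  pickSum-parity : ∀ xs G → signed (parity xs) * pickSum xs G ≈ - pickSum xs (λ y ys → signed (parity ys) * G y ys)
  pickSum-parity xs G = begin
    signed (parity xs) * pickSum xs G
      ≈⟨ pickSum-*ˡ _ xs G ⟨
    pickSum xs (λ y ys → signed (parity xs) * G y ys)
      ≈⟨ pickSum-cong xs (λ y ys eq → trans (*-congʳ (parity-suc xs ys eq)) (*-assoc _ _ _)) ⟩
    pickSum xs (λ y ys → - 1# * (signed (parity ys) * G y ys))
      ≈⟨ pickSum-*ˡ (- 1#) xs _ ⟩
    - 1# * pickSum xs (λ y ys → signed (parity ys) * G y ys)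
      ≈⟨ -1*x≈-x _ ⟩
    - pickSum xs (λ y ys → signed (parity ys) * G y ys) ∎
    where
    parity-length : ∀ (xs ys : List X) → List.length xs ≡ List.length ys → parity xs ≡ parity ys
    parity-length []       []       eq = ≡.refl
    parity-length (_ ∷ xs) (_ ∷ ys) eq = ≡.cong (Sign.- Sign.*_) (parity-length xs ys (≡.cong ℕ.pred eq))

    parity-suc : ∀ xs ys → List.length xs ≡ suc (List.length ys) → signed (parity xs) ≈ - 1# * signed (parity ys)
    parity-suc (_ ∷ xs) ys eq = trans (reflexive (≡.cong (λ s → signed (Sign.- Sign.* s)) (parity-length xs ys (≡.cong ℕ.pred eq))))
      (signed-* Sign.- (parity ys))

  -- Picking an element and then dividing the rest commutes with dividing first and picking from the
  -- left part. The only sign to reconcile occurs when the head `x` goes right: on one side picking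
  -- past `x` costs a minus, on the other `x` moves past `as`, which has one element more than
  -- `as′`.
  pickSum-splitSum : ∀ xs (F : X → List X → List X → Carrier) →
    pickSum xs (λ y ys → splitSum ys (F y)) ≈ splitSum xs (λ as bs → pickSum as (λ y as′ → F y as′ bs))
  pickSum-splitSum []       F = sym (trans (+-identityʳ _) (zeroʳ _))
  pickSum-splitSum (x ∷ xs) F = begin
    splitSum xs (F x) - pickSum xs (λ y ys → splitSum (x ∷ ys) (F y))
      ≈⟨ +-congˡ (-‿cong (begin
        pickSum xs (λ y ys → splitSum (x ∷ ys) (F y))
          ≈⟨ pickSum-cong xs (λ y ys _ → splitSum-∷ x ys (F y)) ⟩
        pickSum xs (λ y ys → splitSum ys (λ as bs → F y (x ∷ as) bs) + splitSum ys (λ as bs → signed (parity as) * F y as (x ∷ bs)))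
          ≈⟨ pickSum-+ xs _ _ ⟩
        pickSum xs (λ y ys → splitSum ys (λ as bs → F y (x ∷ as) bs)) +
        pickSum xs (λ y ys → splitSum ys (λ as bs → signed (parity as) * F y as (x ∷ bs)))
          ≈⟨ +-cong (pickSum-splitSum xs (λ y as bs → F y (x ∷ as) bs))
                    (pickSum-splitSum xs (λ y as bs → signed (parity as) * F y as (x ∷ bs))) ⟩
        U + V ∎)) ⟩
    splitSum xs (F x) - (U + V)
      ≈⟨ +-congˡ (-‿+-comm _ _) ⟨
    splitSum xs (F x) + (- U + - V)
      ≈⟨ +-assoc _ _ _ ⟨
    splitSum xs (F x) - U + - V
      ≈⟨ +-cong (trans (+-congˡ (sym (splitSum-neg xs _))) (sym (splitSum-+ xs _ _)))
                (trans (sym (splitSum-neg xs _)) (splitSum-cong xs λ as bs → sym (pickSum-parity as _))) ⟩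
    splitSum xs (λ as bs → pickSum (x ∷ as) (λ y as′ → F y as′ bs)) +
    splitSum xs (λ as bs → signed (parity as) * pickSum as (λ y as′ → F y as′ (x ∷ bs)))
      ≈⟨ splitSum-∷ x xs _ ⟨
    splitSum (x ∷ xs) (λ as bs → pickSum as (λ y as′ → F y as′ bs)) ∎
    where
    U V : Carrier
    U = splitSum xs (λ as bs → pickSum as (λ y as′ → F y (x ∷ as′) bs))
    V = splitSum xs (λ as bs → pickSum as (λ y as′ → signed (parity as′) * F y as′ (x ∷ bs)))

  -- The junk value 0 for unequal numbers of rows and columns confines the Laplace expansion
  -- to the splits of the right size.
  detₗ : List A → List X → Carrier
  detₗ []       []       = 1#
  detₗ []       (_ ∷ _)  = 0#
  detₗ (r ∷ rs) xs       = pickSum xs (λ y ys → entry r y * detₗ rs ys)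

  detₗ-length : ∀ rs xs → ¬ List.length xs ≡ List.length rs → detₗ rs xs ≈ 0#
  detₗ-length []       []      ≢ with () ← ≢ ≡.refl
  detₗ-length []       (_ ∷ _) ≢ = refl
  detₗ-length (r ∷ rs) xs      ≢ = begin
    pickSum xs (λ y ys → entry r y * detₗ rs ys)
      -- Zero is written as `0# * 0#` so that `pickSum-*ˡ` can pull out a zero factor.
      ≈⟨ pickSum-cong xs (λ y ys eq → trans (*-congˡ (detₗ-length rs ys λ eq′ → ≢ (≡.trans eq (≡.cong suc eq′))))
           (trans (zeroʳ _) (sym (zeroʳ 0#)))) ⟩
    pickSum xs (λ _ _ → 0# * 0#)
      ≈⟨ pickSum-*ˡ 0# xs (λ _ _ → 0#) ⟩
    0# * pickSum xs (λ _ _ → 0#)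
      ≈⟨ zeroˡ _ ⟩
    0# ∎

  -- Induction on the first block of rows, with `pickSum-splitSum` moving the expansion of its first
  -- row inside the sum over divisions. When the block is empty, `detₗ []` kills every division
  -- except the one that sends all columns right, whose sign is positive.
  laplace : ∀ rs rs′ xs → detₗ (rs List.++ rs′) xs ≈ splitSum xs (λ as bs → detₗ rs as * detₗ rs′ bs)
  laplace []       rs′ xs = sym (base xs (detₗ rs′))
    where
    base : ∀ xs (G : List X → Carrier) → splitSum xs (λ as bs → detₗ [] as * G bs) ≈ G xs
    base []       G = trans (+-identityʳ _) (trans (*-identityˡ _) (*-identityˡ _))
    base (x ∷ xs) G = begin
      splitSum (x ∷ xs) (λ as bs → detₗ [] as * G bs)
        ≈⟨ splitSum-∷ x xs _ ⟩
      splitSum xs (λ _ bs → 0# * G bs) + splitSum xs (λ as bs → signed (parity as) * (detₗ [] as * G (x ∷ bs)))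
        ≈⟨ +-cong (trans (splitSum-*ˡ 0# xs (λ _ → G)) (zeroˡ _))
                  (splitSum-cong xs λ { [] bs → *-identityˡ _ ; (_ ∷ _) bs → trans (*-congˡ (zeroˡ _)) (trans (zeroʳ _) (sym (zeroˡ _))) }) ⟩
      0# + splitSum xs (λ as bs → detₗ [] as * G (x ∷ bs))
        ≈⟨ +-identityˡ _ ⟩
      splitSum xs (λ as bs → detₗ [] as * G (x ∷ bs))
        ≈⟨ base xs (G ∘ (x ∷_)) ⟩
      G (x ∷ xs) ∎
  laplace (r ∷ rs) rs′ xs = begin
    pickSum xs (λ y ys → entry r y * detₗ (rs List.++ rs′) ys)
      ≈⟨ pickSum-cong xs (λ y ys _ → trans (*-congˡ (laplace rs rs′ ys)) (trans (sym (splitSum-*ˡ _ ys _))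
           (splitSum-cong ys λ _ _ → sym (*-assoc _ _ _)))) ⟩
    pickSum xs (λ y ys → splitSum ys (λ as bs → entry r y * detₗ rs as * detₗ rs′ bs))
      ≈⟨ pickSum-splitSum xs _ ⟩
    splitSum xs (λ as bs → pickSum as (λ y as′ → entry r y * detₗ rs as′ * detₗ rs′ bs))
      ≈⟨ splitSum-cong xs (λ as bs → pickSum-*ʳ _ as _) ⟩
    splitSum xs (λ as bs → detₗ (r ∷ rs) as * detₗ rs′ bs) ∎

  sum≈pickSum : ∀ {n} (v : Vector X (suc n)) F →
                sum (λ j → sg j * F (v j) (tabulate (removeAt v j))) ≈ pickSum (tabulate v) F
  sum≈pickSum {zero}  v F = +-cong (*-identityˡ _) (sym -0#≈0#)
  sum≈pickSum {suc n} v F = +-cong (*-identityˡ _) (begin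
    sum (λ j → - 1# * sg j * F (v (suc j)) (head v ∷ tabulate (removeAt (tail v) j)))
      ≈⟨ sum-cong-≋ {suc n} (λ j → *-assoc (- 1#) (sg j) (F (v (suc j)) (head v ∷ tabulate (removeAt (tail v) j)))) ⟩
    sum (λ j → - 1# * (sg j * F (v (suc j)) (head v ∷ tabulate (removeAt (tail v) j))))
      ≈⟨ *-distribˡ-sum (- 1#) (λ j → sg j * F (v (suc j)) (head v ∷ tabulate (removeAt (tail v) j))) ⟨
    - 1# * sum (λ j → sg j * F (v (suc j)) (head v ∷ tabulate (removeAt (tail v) j)))
      ≈⟨ -1*x≈-x _ ⟩
    - sum (λ j → sg j * F (v (suc j)) (head v ∷ tabulate (removeAt (tail v) j)))
      ≈⟨ -‿cong (sum≈pickSum (tail v) (λ y ys → F y (head v ∷ ys))) ⟩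
    - pickSum (tabulate (tail v)) (λ y ys → F y (head v ∷ ys)) ∎)

  det≈detₗ : ∀ {n} (r : Vector A n) (v : Vector X n) → det (λ i j → entry (r i) (v j)) ≈ detₗ (tabulate r) (tabulate v)
  det≈detₗ {zero}  r v = refl
  det≈detₗ {suc n} r v = trans
    (sum-cong-≋ λ j → *-congˡ {x = sg j} (*-congˡ {x = entry (head r) (v j)} (det≈detₗ (tail r) (removeAt v j))))
    (sum≈pickSum v (λ y ys → entry (head r) y * detₗ (tabulate (tail r)) ys))

-- Divisions of decreasing sequences

-- The members of `splits xs` as an inductive family, so that later proofs recurse on the division
-- instead of on list membership.
data Split {X : Set x} : Sign → List X → List X → List X → Set x where
  []    : Split Sign.+ [] [] []
  left  : ∀ {σ x as bs xs} → Split σ as bs xs → Split σ (x ∷ as) bs (x ∷ xs)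
  right : ∀ {σ x as bs xs} → Split σ as bs xs → Split (parity as Sign.* σ) as (x ∷ bs) (x ∷ xs)

∈-splits⁺ : ∀ {σ as bs} {xs : List X} → Split σ as bs xs → (σ , as , bs) ∈ splits xs
∈-splits⁺ []        = here ≡.refl
∈-splits⁺ (left s)  = ∈-++⁺ˡ (∈-map⁺ (takeˡ _) (∈-splits⁺ s))
∈-splits⁺ {xs = x ∷ xs} (right s) = ∈-++⁺ʳ (map (takeˡ x) (splits xs)) (∈-map⁺ (takeʳ _) (∈-splits⁺ s))

∈-splits⁻ : ∀ {σ as bs} (xs : List X) → (σ , as , bs) ∈ splits xs → Split σ as bs xs
∈-splits⁻ []       (here ≡.refl) = []
∈-splits⁻ (x ∷ xs) s∈ with ∈-++⁻ (map (takeˡ x) (splits xs)) s∈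
... | inj₁ s∈ˡ with _ , s∈′ , ≡.refl ← ∈-map⁻ (takeˡ x) s∈ˡ = left (∈-splits⁻ xs s∈′)
... | inj₂ s∈ʳ with _ , s∈′ , ≡.refl ← ∈-map⁻ (takeʳ x) s∈ʳ = right (∈-splits⁻ xs s∈′)

split-All : ∀ {P : Pred X p} {σ as bs xs} → Split σ as bs xs → All P xs → All P as × All P bs
split-All []        []         = [] , []
split-All (left s)  (px ∷ pxs) = let pas , pbs = split-All s pxs in px ∷ pas , pbs
split-All (right s) (px ∷ pxs) = let pas , pbs = split-All s pxs in pas , px ∷ pbs

split-AllPairs : ∀ {R : Rel X p} {σ as bs xs} → Split σ as bs xs → AllPairs R xs → AllPairs R as × AllPairs R bs
split-AllPairs []        []         = [] , []
split-AllPairs (left s)  (px ∷ pxs) = let pas , pbs = split-AllPairs s pxs in proj₁ (split-All s px) ∷ pas , pbs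
split-AllPairs (right s) (px ∷ pxs) = let pas , pbs = split-AllPairs s pxs in pas , proj₂ (split-All s px) ∷ pbs

split-length : ∀ {σ as bs} {xs : List X} → Split σ as bs xs → List.length as ℕ.+ List.length bs ≡ List.length xs
split-length []        = ≡.refl
split-length (left s)  = ≡.cong suc (split-length s)
split-length {as = as} (right s) = ≡.trans (ℕ.+-suc (List.length as) _) (≡.cong suc (split-length s))

split-[] : ∀ {σ as} {xs : List X} → Split σ as [] xs → as ≡ xs
split-[] []       = ≡.refl
split-[] (left s) = ≡.cong (_ ∷_) (split-[] s)

-- The position of the head separates the two halves of the list: in one the left part starts with
-- `x`, in the other it draws only on `xs`, which omits `x`.
splits-unique : {xs : List X} → Unique xs → Unique (splits xs)
splits-unique []       = [] ∷ []
splits-unique {xs = x ∷ xs} (x∉xs ∷ u) = Unique.++⁺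
  (Unique.map⁺ (λ { ≡.refl → ≡.refl }) (splits-unique u))
  (Unique.map⁺ takeʳ-injective (splits-unique u))
  λ (∈ˡ , ∈ʳ) → disjoint ∈ˡ ∈ʳ
  where
  takeʳ-injective : ∀ {s t : Sign × List _ × List _} → takeʳ x s ≡ takeʳ x t → s ≡ t
  takeʳ-injective {σ , as , bs} {τ , cs , ds} eq
    with ≡.refl ← ≡.cong (proj₁ ∘ proj₂) eq | ≡.refl ← ≡.cong (proj₂ ∘ proj₂) eq =
      ≡.cong (_, as , bs) (Sign.*-cancelˡ-≡ (parity as) σ τ (≡.cong proj₁ eq))

  disjoint : ∀ {s} → s ∈ map (takeˡ x) (splits xs) → ¬ s ∈ map (takeʳ x) (splits xs)
  disjoint ∈ˡ ∈ʳ with _ , _ , ≡.refl ← ∈-map⁻ (takeˡ x) ∈ˡ | _ , s∈ , ≡.refl ← ∈-map⁻ (takeʳ x) ∈ʳ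
    with x≢x ∷ _ ← proj₁ (split-All (∈-splits⁻ xs s∈) x∉xs) = x≢x ≡.refl

Decreasing : List ℕ → Set
Decreasing = AllPairs _>_

-- Each head is the maximum of its list; if each lay in the tail of the other list, each would
-- exceed the other.
decreasing-head : ∀ {x y xs ys} → Decreasing (x ∷ xs) → Decreasing (y ∷ ys) → x ∈ y ∷ ys → y ∈ x ∷ xs → y ≡ x
decreasing-head _ _ (here x≡y) _          = ≡.sym x≡y
decreasing-head _ _ (there _)  (here y≡x) = y≡x
decreasing-head (x> ∷ _) (y> ∷ _) (there x∈) (there y∈) = contradiction (All.lookup x> y∈) (ℕ.<-asym (All.lookup y> x∈))

∈-tail : ∀ {x z : A} {xs} → z ∈ x ∷ xs → ¬ z ≡ x → z ∈ xs
∈-tail (here z≡x) z≢x = contradiction z≡x z≢x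
∈-tail (there z∈) _   = z∈

-- Set-theoretic data suffice because order is forced. The head of `xs` is the overall maximum, so
-- it must be the head of whichever part contains it; both heads are removed and the argument
-- repeats.
decreasing-split : ∀ {as bs xs} → Decreasing as → Decreasing bs → Decreasing xs → Disjoint as bs →
                   (∀ {z} → z ∈ as → z ∈ xs) → (∀ {z} → z ∈ bs → z ∈ xs) →
                   (∀ {z} → z ∈ xs → z ∈ as ⊎ z ∈ bs) → ∃[ σ ] Split σ as bs xs
decreasing-split {[]}     {[]}    {[]} _ _ _ _ _ _ _ = Sign.+ , []
decreasing-split {_ ∷ _}  {_}     {[]} _ _ _ _ as⊆ _ _ with () ← as⊆ (here ≡.refl)
decreasing-split {[]}     {_ ∷ _} {[]} _ _ _ _ _ bs⊆ _ with () ← bs⊆ (here ≡.refl)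
decreasing-split {as} {bs} {x ∷ xs} as> bs> xs> as∥bs as⊆ bs⊆ ⊆∪ with ⊆∪ (here ≡.refl)
decreasing-split {a ∷ as} {bs} {x ∷ xs} as>@(a> ∷ as>′) bs> xs>@(x> ∷ xs>′) as∥bs as⊆ bs⊆ ⊆∪ | inj₁ x∈
  with ≡.refl ← decreasing-head xs> as> x∈ (as⊆ (here ≡.refl))
  with σ , s ← decreasing-split as>′ bs> xs>′ (λ (z∈as , z∈bs) → as∥bs (there z∈as , z∈bs))
    (λ z∈ → ∈-tail (as⊆ (there z∈)) λ { ≡.refl → ℕ.<-irrefl ≡.refl (All.lookup a> z∈) })
    (λ z∈ → ∈-tail (bs⊆ z∈) λ { ≡.refl → as∥bs (here ≡.refl , z∈) })
    (λ z∈ → Sum.map₁ (λ z∈as → ∈-tail z∈as λ { ≡.refl → ℕ.<-irrefl ≡.refl (All.lookup x> z∈) }) (⊆∪ (there z∈)))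
  = σ , left s
decreasing-split {as} {b ∷ bs} {x ∷ xs} as> bs>@(b> ∷ bs>′) xs>@(x> ∷ xs>′) as∥bs as⊆ bs⊆ ⊆∪ | inj₂ x∈
  with ≡.refl ← decreasing-head xs> bs> x∈ (bs⊆ (here ≡.refl))
  with σ , s ← decreasing-split as> bs>′ xs>′ (λ (z∈as , z∈bs) → as∥bs (z∈as , there z∈bs))
    (λ z∈ → ∈-tail (as⊆ z∈) λ { ≡.refl → as∥bs (z∈ , here ≡.refl) })
    (λ z∈ → ∈-tail (bs⊆ (there z∈)) λ { ≡.refl → ℕ.<-irrefl ≡.refl (All.lookup b> z∈) })
    (λ z∈ → Sum.map₂ (λ z∈bs → ∈-tail z∈bs λ { ≡.refl → ℕ.<-irrefl ≡.refl (All.lookup x> z∈) }) (⊆∪ (there z∈)))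
  = parity as Sign.* σ , right s

-- Equality is the case of a division with empty right part.
decreasing-≡ : ∀ {xs ys} → Decreasing xs → Decreasing ys →
               (∀ {z} → z ∈ xs → z ∈ ys) → (∀ {z} → z ∈ ys → z ∈ xs) → xs ≡ ys
decreasing-≡ xs> ys> xs⊆ys ys⊆xs =
  split-[] (proj₂ (decreasing-split xs> [] ys> (λ { (_ , ()) }) xs⊆ys (λ ()) (inj₁ ∘ ys⊆xs)))

-- Inversion signs of shuffles

module PairProductProperties {c ℓ} (M : CommutativeMonoid c ℓ) where
  open CommutativeMonoid M
  open PairProduct M
  open import Algebra.Properties.CommutativeMonoid.Sum M using (sum-cong-≋)

  pairs-cong : ∀ {n} {f g : Fin n → Fin n → Carrier} → (∀ i j → f i j ≈ g i j) → pairs f ≈ pairs g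
  pairs-cong {zero}  f≈g = refl
  pairs-cong {suc n} f≈g = ∙-cong (sum-cong-≋ λ j → f≈g zero (suc j)) (pairs-cong λ i j → f≈g (suc i) (suc j))

open import Algebra.Properties.CommutativeMonoid.Sum Sign.*-commutativeMonoid
  using () renaming (sum to signProduct; sum-cong-≗ to signProduct-cong; sum-replicate-zero to signProduct-+)
open PairProduct Sign.*-commutativeMonoid using () renaming (pairs to signPairs)
open PairProductProperties Sign.*-commutativeMonoid using () renaming (pairs-cong to signPairs-cong)

inversion : ∀ {m n} → Fin m → Fin n → Sign
inversion i j = if does (toℕ j ℕ.<? toℕ i) then Sign.- else Sign.+

sgn-cong : ∀ {m n} (π τ : Permutation m n) → (∀ i → π ⟨$⟩ʳ i ≡ τ ⟨$⟩ʳ i) → sgn π ≡ sgn τ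
sgn-cong π τ π≗τ = signPairs-cong λ i j → ≡.cong₂ inversion (π≗τ i) (π≗τ j)

module _ {m n : ℕ} where
  ↑ˡ<↑ʳ : (i : Fin m) (j : Fin n) → toℕ (i ↑ˡ n) < toℕ (m ↑ʳ j)
  ↑ˡ<↑ʳ i j rewrite Fin.toℕ-↑ˡ i n | Fin.toℕ-↑ʳ m j = ℕ.≤-trans (Fin.toℕ<n i) (ℕ.m≤m+n m _)

  -- An element of Fin m ⊎ Fin n stands for a position in the concatenation of vectors of
  -- lengths m and n.
  inv⊎ : Fin m ⊎ Fin n → Fin m ⊎ Fin n → Sign
  inv⊎ p q = inversion (join m n p) (join m n q)

  leftSign : Fin m ⊎ Fin n → Sign
  leftSign = [ (λ _ → Sign.-) , (λ _ → Sign.+) ]′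

inv⊎-left : ∀ {m n} (p q : Fin m ⊎ Fin n) → inv⊎ {suc m} (Sum.map₁ suc p) (Sum.map₁ suc q) ≡ inv⊎ p q
inv⊎-left (inj₁ _) (inj₁ _) = ≡.refl
inv⊎-left (inj₁ _) (inj₂ _) = ≡.refl
inv⊎-left (inj₂ _) (inj₁ _) = ≡.refl
inv⊎-left (inj₂ _) (inj₂ _) = ≡.refl

-- A new head of the right block shifts the right positions and leaves the left ones in place.
-- Relative order survives because every left position precedes every right one.
inv⊎-right : ∀ {m n} (p q : Fin m ⊎ Fin n) → inv⊎ {m} {suc n} (Sum.map₂ suc p) (Sum.map₂ suc q) ≡ inv⊎ p q
inv⊎-right {m} {n} (inj₁ i) (inj₁ j)
  rewrite Fin.toℕ-↑ˡ i (suc n) | Fin.toℕ-↑ˡ j (suc n) | Fin.toℕ-↑ˡ i n | Fin.toℕ-↑ˡ j n = ≡.refl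
inv⊎-right {m} {n} (inj₁ i) (inj₂ j) = ≡.cong (if_then Sign.- else Sign.+)
  (≡.trans (dec-false (_ ℕ.<? _) (ℕ.<-asym (↑ˡ<↑ʳ i (suc j)))) (≡.sym (dec-false (_ ℕ.<? _) (ℕ.<-asym (↑ˡ<↑ʳ i j)))))
inv⊎-right {m} {n} (inj₂ i) (inj₁ j) = ≡.cong (if_then Sign.- else Sign.+)
  (≡.trans (dec-true (_ ℕ.<? _) (↑ˡ<↑ʳ j (suc i))) (≡.sym (dec-true (_ ℕ.<? _) (↑ˡ<↑ʳ j i))))
inv⊎-right {m} {n} (inj₂ i) (inj₂ j)
  rewrite Fin.toℕ-↑ʳ m (suc i) | Fin.toℕ-↑ʳ m (suc j) | Fin.toℕ-↑ʳ m i | Fin.toℕ-↑ʳ m j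
  | ℕ.+-suc m (toℕ i) | ℕ.+-suc m (toℕ j) = ≡.refl

-- Source of the factor `parity as` in a right step: the first right position comes after all left
-- positions and before the other right ones, so it is inverted exactly with the later elements sent
-- left.
inv⊎-zero : ∀ {m n} (p : Fin m ⊎ Fin n) → inv⊎ {m} {suc n} (inj₂ zero) (Sum.map₂ suc p) ≡ leftSign p
inv⊎-zero (inj₁ i) = ≡.cong (if_then Sign.- else Sign.+) (dec-true (_ ℕ.<? _) (↑ˡ<↑ʳ i zero))
inv⊎-zero {m} (inj₂ j) = ≡.cong (if_then Sign.- else Sign.+) (dec-false (_ ℕ.<? _) (ℕ.<-asym
  (≡.subst₂ _<_ (≡.sym (Fin.toℕ-↑ʳ m zero)) (≡.sym (Fin.toℕ-↑ʳ m (suc j))) (ℕ.+-monoʳ-< m (s≤s z≤n)))))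

-- Positions are kept in `Fin m ⊎ Fin n` so that prepending an element to either part is a
-- `Sum.map`. The field `lefts` strengthens the induction: a right step needs the parity of the
-- number of elements already sent left.
record Shuffle {X : Set x} {m n k} (u : Vector X m) (v : Vector X n) (w : Vector X k) (as : List X) (σ : Sign) : Set x where
  field
    to      : Fin k → Fin m ⊎ Fin n
    from    : Fin m ⊎ Fin n → Fin k
    to∘from : ∀ p → to (from p) ≡ p
    from∘to : ∀ i → from (to i) ≡ i
    values  : ∀ i → [ u , v ]′ (to i) ≡ w i
    lefts   : signProduct (leftSign ∘ to) ≡ parity as
    sign    : signPairs (λ i j → inv⊎ (to i) (to j)) ≡ σ

  permutation : Permutation k (m ℕ.+ n)
  permutation = Perm.permutation (join m n ∘ to) (from ∘ splitAt m)
    (λ i → ≡.trans (≡.cong (join m n) (to∘from (splitAt m i))) (Fin.join-splitAt m n i))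
    (λ i → ≡.trans (≡.cong from (Fin.splitAt-join m n (to i))) (from∘to i))

split⇒shuffle : ∀ {m n k σ as bs} {xs : List X} → Split σ as bs xs →
                (u : Vector X m) (v : Vector X n) (w : Vector X k) →
                tabulate u ≡ as → tabulate v ≡ bs → tabulate w ≡ xs → Shuffle u v w as σ
split⇒shuffle {m = zero} {zero} {zero} [] u v w _ _ _ = record
  { to = λ () ; from = [ (λ ()) , (λ ()) ]′ ; to∘from = λ { (inj₁ ()) ; (inj₂ ()) } ; from∘to = λ ()
  ; values = λ () ; lefts = ≡.refl ; sign = ≡.refl }
split⇒shuffle {m = suc m} {n} {suc k} {σ} {_ ∷ as} (left s) u v w u≡ v≡ w≡
  with S ← split⇒shuffle s (tail u) v (tail w) (List.∷-injectiveʳ u≡) v≡ (List.∷-injectiveʳ w≡) = record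
  { to      = to
  ; from    = from
  ; to∘from = λ { (inj₁ zero) → ≡.refl ; (inj₁ (suc i)) → ≡.cong (Sum.map₁ suc) (S.to∘from (inj₁ i))
                ; (inj₂ j) → ≡.cong (Sum.map₁ suc) (S.to∘from (inj₂ j)) }
  ; from∘to = λ { zero → ≡.refl ; (suc i) → ≡.trans (from-suc (S.to i)) (≡.cong suc (S.from∘to i)) }
  ; values  = λ { zero → ≡.trans (List.∷-injectiveˡ u≡) (≡.sym (List.∷-injectiveˡ w≡))
                ; (suc i) → ≡.trans (Sum.[,]-map (S.to i)) (S.values i) }
  ; lefts   = ≡.cong (Sign.- Sign.*_) (≡.trans (signProduct-cong λ i → Sum.[,]-map (S.to i)) S.lefts)
  -- The head takes position `zero`, which no other position precedes, so it creates no inversion.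
  ; sign    = ≡.cong₂ Sign._*_ (signProduct-+ k)
                (≡.trans (signPairs-cong λ i j → inv⊎-left (S.to i) (S.to j)) S.sign)
  }
  where
  module S = Shuffle S

  to : Fin (suc k) → Fin (suc m) ⊎ Fin n
  to zero    = inj₁ zero
  to (suc i) = Sum.map₁ suc (S.to i)

  from : Fin (suc m) ⊎ Fin n → Fin (suc k)
  from (inj₁ zero)    = zero
  from (inj₁ (suc i)) = suc (S.from (inj₁ i))
  from (inj₂ j)       = suc (S.from (inj₂ j))

  from-suc : ∀ p → from (Sum.map₁ suc p) ≡ suc (S.from p)
  from-suc (inj₁ _) = ≡.refl
  from-suc (inj₂ _) = ≡.refl
split⇒shuffle {m = m} {suc n} {suc k} {as = as} (right {σ} s) u v w u≡ v≡ w≡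
  with S ← split⇒shuffle s u (tail v) (tail w) u≡ (List.∷-injectiveʳ v≡) (List.∷-injectiveʳ w≡) = record
  { to      = to
  ; from    = from
  ; to∘from = λ { (inj₂ zero) → ≡.refl ; (inj₂ (suc i)) → ≡.cong (Sum.map₂ suc) (S.to∘from (inj₂ i))
                ; (inj₁ j) → ≡.cong (Sum.map₂ suc) (S.to∘from (inj₁ j)) }
  ; from∘to = λ { zero → ≡.refl ; (suc i) → ≡.trans (from-suc (S.to i)) (≡.cong suc (S.from∘to i)) }
  ; values  = λ { zero → ≡.trans (List.∷-injectiveˡ v≡) (≡.sym (List.∷-injectiveˡ w≡))
                ; (suc i) → ≡.trans (Sum.[,]-map (S.to i)) (S.values i) }
  ; lefts   = ≡.trans (signProduct-cong λ i → Sum.[,]-map (S.to i)) S.lefts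
  ; sign    = ≡.cong₂ Sign._*_
                (≡.trans (signProduct-cong λ i → inv⊎-zero (S.to i)) S.lefts)
                (≡.trans (signPairs-cong λ i j → inv⊎-right (S.to i) (S.to j)) S.sign)
  }
  where
  module S = Shuffle S

  to : Fin (suc k) → Fin m ⊎ Fin (suc n)
  to zero    = inj₂ zero
  to (suc i) = Sum.map₂ suc (S.to i)

  from : Fin m ⊎ Fin (suc n) → Fin (suc k)
  from (inj₂ zero)    = zero
  from (inj₂ (suc i)) = suc (S.from (inj₂ i))
  from (inj₁ j)       = suc (S.from (inj₁ j))

  from-suc : ∀ p → from (Sum.map₂ suc p) ≡ suc (S.from p)
  from-suc (inj₁ _) = ≡.refl
  from-suc (inj₂ _) = ≡.refl

-- Overlaps

-- The entries of xs + ρₘ for a raw list xs of parts.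
shifted : ℕ → List ℕ → List ℕ
shifted m xs = tabulate {n = m} λ i → nth xs (toℕ i) ℕ.+ (m ∸ suc (toℕ i))

entries : ℕ → Partition → List ℕ
entries m μ = shifted m (parts μ)

shifted-< : ∀ m {x xs} → All (x ≥_) xs → All (x ℕ.+ m >_) (shifted m xs)
shifted-< zero    _  = []
shifted-< (suc m) {x} {[]} [] =
  ≡.subst (m <_) (≡.sym (ℕ.+-suc x m)) (s≤s (ℕ.m≤n+m m x)) ∷
  All.map (λ {z} z< → ≡.subst (z <_) (≡.sym (ℕ.+-suc x m)) (ℕ.m<n⇒m<1+n z<)) (shifted-< m [])
shifted-< (suc m) {x} {y ∷ xs} (x≥y ∷ x≥) =
  ≡.subst (y ℕ.+ m <_) (≡.sym (ℕ.+-suc x m)) (s≤s (ℕ.+-monoˡ-≤ m x≥y)) ∷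
  All.map (λ {z} z< → ≡.subst (z <_) (≡.sym (ℕ.+-suc x m)) (ℕ.m<n⇒m<1+n z<)) (shifted-< m x≥)

shifted-decreasing : ∀ m {xs} → AllPairs _≥_ xs → Decreasing (shifted m xs)
shifted-decreasing zero    _  = []
shifted-decreasing (suc m) {[]}     []        = shifted-< m [] ∷ shifted-decreasing m []
shifted-decreasing (suc m) {x ∷ xs} (x≥ ∷ xs≥) = shifted-< m x≥ ∷ shifted-decreasing m xs≥

entries-decreasing : ∀ m μ → Decreasing (entries m μ)
entries-decreasing m μ = shifted-decreasing m (Linked⇒AllPairs (λ x≥y y≥z → ℕ.≤-trans y≥z x≥y) (Partition.nonincreasing μ))

shifted-injective : ∀ m {xs ys} → List.length xs ≤ m → List.length ys ≤ m → All (0 <_) xs → All (0 <_) ys →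
                    shifted m xs ≡ shifted m ys → xs ≡ ys
shifted-injective _       {[]}     {[]}     _ _ _ _ _ = ≡.refl
-- Past the end of a list a padded zero is read, which a positive part cannot equal.
shifted-injective (suc m) {x ∷ _}  {[]}     _ _ (x>0 ∷ _) _ eq =
  contradiction (ℕ.+-cancelʳ-≡ m x 0 (List.∷-injectiveˡ eq)) (ℕ.>⇒≢ x>0)
shifted-injective (suc m) {[]}     {y ∷ _}  _ _ _ (y>0 ∷ _) eq =
  contradiction (≡.sym (ℕ.+-cancelʳ-≡ m 0 y (List.∷-injectiveˡ eq))) (ℕ.>⇒≢ y>0)
shifted-injective (suc m) {x ∷ xs} {y ∷ ys} (s≤s lx) (s≤s ly) (_ ∷ xs>0) (_ ∷ ys>0) eq =
  ≡.cong₂ _∷_ (ℕ.+-cancelʳ-≡ m x y (List.∷-injectiveˡ eq)) (shifted-injective m lx ly xs>0 ys>0 (List.∷-injectiveʳ eq))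

entries-injective : ∀ m {μ ν} → length μ ≤ m → length ν ≤ m → entries m μ ≡ entries m ν → μ ≡ ν
entries-injective m {μ} {ν} lμ lν eq = partition-≡ (shifted-injective m lμ lν (Partition.positive μ) (Partition.positive ν) eq)

infixr 5 _∷⁺_

-- In a non-increasing sequence only zeros follow a zero, so cutting there removes exactly the
-- trailing zeros.
_∷⁺_ : ℕ → List ℕ → List ℕ
zero  ∷⁺ xs = []
suc n ∷⁺ xs = suc n ∷ xs

-- The number of later entries is the component of `ρ` at that place, so this undoes `shifted` on
-- decreasing lists.
unshifted : List ℕ → List ℕ
unshifted []       = []
unshifted (x ∷ xs) = (x ∸ List.length xs) ∷⁺ unshifted xs

unshifted-length : ∀ xs → List.length (unshifted xs) ≤ List.length xs
unshifted-length []       = z≤n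
unshifted-length (x ∷ xs) with x ∸ List.length xs
... | zero  = z≤n
... | suc _ = s≤s (unshifted-length xs)

unshifted-positive : ∀ xs → All (0 <_) (unshifted xs)
unshifted-positive []       = []
unshifted-positive (x ∷ xs) with x ∸ List.length xs
... | zero  = []
... | suc _ = s≤s z≤n ∷ unshifted-positive xs

-- From one entry to the next the value drops by at least one and the subtracted staircase by
-- exactly one, so strict decrease turns into weak decrease.
unshifted-≤ : ∀ {x xs} → Decreasing (x ∷ xs) → All (x ∸ List.length xs ≥_) (unshifted xs)
unshifted-≤ {x} {[]}     _ = []
unshifted-≤ {x} {y ∷ xs} ((x>y ∷ _) ∷ ys>) = ∷⁺⁺ (ℕ.∸-monoˡ-≤ (suc (List.length xs)) x>y) (unshifted-≤ ys>)
  where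
  ∷⁺⁺ : ∀ {m n ys} → n ≤ m → All (n ≥_) ys → All (m ≥_) (n ∷⁺ ys)
  ∷⁺⁺ {n = zero}  _   _   = []
  ∷⁺⁺ {n = suc n} n≤m n≥ = n≤m ∷ All.map (λ k≤n → ℕ.≤-trans k≤n n≤m) n≥

unshifted-nonincreasing : ∀ {xs} → Decreasing xs → AllPairs _≥_ (unshifted xs)
unshifted-nonincreasing {[]}     _ = []
unshifted-nonincreasing {x ∷ xs} d@(_ ∷ xs>) with x ∸ List.length xs | unshifted-≤ d
... | zero  | _  = []
... | suc _ | x≥ = x≥ ∷ unshifted-nonincreasing xs>

-- Ensures that the truncated subtraction in `unshifted` loses nothing.
length≤head : ∀ {x xs} → Decreasing (x ∷ xs) → List.length xs ≤ x
length≤head {xs = []}     _ = z≤n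
length≤head {xs = y ∷ xs} ((x>y ∷ _) ∷ ys>) = ℕ.≤-trans (s≤s (length≤head ys>)) x>y

shifted-unshifted : ∀ {xs} → Decreasing xs → shifted (List.length xs) (unshifted xs) ≡ xs
shifted-unshifted {[]}     _ = ≡.refl
shifted-unshifted {x ∷ xs} d@(_ ∷ xs>)
  with x ∸ List.length xs in eq | unshifted-≤ d | shifted-unshifted xs> | ℕ.m∸n+n≡m (length≤head d)
... | suc k | _  | ih | x≡ = ≡.cong₂ _∷_ x≡ ih
-- Here `∷⁺` has dropped the tail. It was empty already, since its parts are positive and yet
-- bounded by zero.
... | zero  | 0≥ | ih | x≡ = ≡.cong₂ _∷_ x≡ (≡.trans (≡.cong (shifted _) (≡.sym (none (unshifted-positive xs) 0≥))) ih)
  where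
  none : ∀ {ys} → All (0 <_) ys → All (0 ≥_) ys → ys ≡ []
  none []        _         = ≡.refl
  none (0<y ∷ _) (y≤0 ∷ _) = contradiction y≤0 (ℕ.<⇒≱ 0<y)

fromEntries : ∀ {xs} → Decreasing xs → Σ[ μ ∈ Partition ] length μ ≤ List.length xs × entries (List.length xs) μ ≡ xs
fromEntries {xs} d =
  mkPartition (unshifted xs) (AllPairs⇒Linked (unshifted-nonincreasing d)) (unshifted-positive xs) ,
  unshifted-length xs , shifted-unshifted d

tabulate-injective : ∀ {n} (f : Vector ℕ n) → Decreasing (tabulate f) → ∀ {i j} → f i ≡ f j → i ≡ j
tabulate-injective f _         {zero}  {zero}  _  = ≡.refl
tabulate-injective f (f₀> ∷ _) {zero}  {suc j} eq =
  contradiction (≡.sym eq) (ℕ.<⇒≢ (All.lookup f₀> (∈-tabulate⁺ {f = tail f} j)))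
tabulate-injective f (f₀> ∷ _) {suc i} {zero}  eq =
  contradiction eq (ℕ.<⇒≢ (All.lookup f₀> (∈-tabulate⁺ {f = tail f} i)))
tabulate-injective f (_ ∷ f>)  {suc i} {suc j} eq = ≡.cong suc (tabulate-injective (tail f) f> eq)

module Overlap (m n : ℕ) (μ ν κ : Partition) (o : IsOverlap m n μ ν κ) where
  private
    u : Vector ℕ m
    u = pad m μ ⊹ ρ m

    v : Vector ℕ n
    v = pad n ν ⊹ ρ n

    w : Vector ℕ (m ℕ.+ n)
    w = pad (m ℕ.+ n) κ ⊹ ρ (m ℕ.+ n)

    π : Permutation (m ℕ.+ n) (m ℕ.+ n)
    π = proj₁ (proj₂ o)

    uv≡w : ∀ i → (u ++ v) (π ⟨$⟩ʳ i) ≡ w i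
    uv≡w = proj₂ (proj₂ o)

    w≡uv : ∀ i → w (π ⟨$⟩ˡ i) ≡ (u ++ v) i
    w≡uv i = ≡.trans (≡.sym (uv≡w _)) (≡.cong (u ++ v) (Perm.inverseʳ π))

  -- `w` is strictly decreasing, hence injective, and `u ++ v` is a rearrangement of it.
  ++-injective : ∀ {i j} → (u ++ v) i ≡ (u ++ v) j → i ≡ j
  ++-injective {i} {j} eq = ≡.trans (≡.sym (Perm.inverseʳ π)) (≡.trans (≡.cong (π ⟨$⟩ʳ_)
    (tabulate-injective w (entries-decreasing (m ℕ.+ n) κ) (≡.trans (w≡uv i) (≡.trans eq (≡.sym (w≡uv j))))))
    (Perm.inverseʳ π))

  ∈-entriesˡ : ∀ {z} → z ∈ entries m μ → z ∈ entries (m ℕ.+ n) κ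
  ∈-entriesˡ z∈ with i , ≡.refl ← ∈-tabulate⁻ {f = u} z∈ =
    ≡.subst (_∈ entries (m ℕ.+ n) κ) (≡.trans (w≡uv (i ↑ˡ n)) (lookup-++ˡ u v i)) (∈-tabulate⁺ {f = w} _)

  ∈-entriesʳ : ∀ {z} → z ∈ entries n ν → z ∈ entries (m ℕ.+ n) κ
  ∈-entriesʳ z∈ with j , ≡.refl ← ∈-tabulate⁻ {f = v} z∈ =
    ≡.subst (_∈ entries (m ℕ.+ n) κ) (≡.trans (w≡uv (m ↑ʳ j)) (lookup-++ʳ u v j)) (∈-tabulate⁺ {f = w} _)

  ∈-entries⁻ : ∀ {z} → z ∈ entries (m ℕ.+ n) κ → z ∈ entries m μ ⊎ z ∈ entries n ν
  ∈-entries⁻ z∈ with k , ≡.refl ← ∈-tabulate⁻ {f = w} z∈ with splitAt m (π ⟨$⟩ʳ k) | uv≡w k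
  ... | inj₁ i | uᵢ≡wₖ = inj₁ (≡.subst (_∈ entries m μ) uᵢ≡wₖ (∈-tabulate⁺ {f = u} i))
  ... | inj₂ j | vⱼ≡wₖ = inj₂ (≡.subst (_∈ entries n ν) vⱼ≡wₖ (∈-tabulate⁺ {f = v} j))

  disjoint : Disjoint (entries m μ) (entries n ν)
  disjoint (z∈u , z∈v) with i , ≡.refl ← ∈-tabulate⁻ {f = u} z∈u | j , uᵢ≡vⱼ ← ∈-tabulate⁻ {f = v} z∈v =
    ℕ.<⇒≢ (↑ˡ<↑ʳ i j) (≡.cong toℕ (++-injective
      (≡.trans (lookup-++ˡ u v i) (≡.trans uᵢ≡vⱼ (≡.sym (lookup-++ʳ u v j))))))

  split : ∃[ σ ] Split σ (entries m μ) (entries n ν) (entries (m ℕ.+ n) κ)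
  split = decreasing-split (entries-decreasing m μ) (entries-decreasing n ν) (entries-decreasing (m ℕ.+ n) κ)
    disjoint ∈-entriesˡ ∈-entriesʳ ∈-entries⁻

  -- The permutation `π` of the given witness and the one built from the division both rearrange
  -- `u ++ v` into `w`. As `u ++ v` has no repeated entry, they agree pointwise.
  sgn≡ : ∀ {σ} → Split σ (entries m μ) (entries n ν) (entries (m ℕ.+ n) κ) → sgn π ≡ σ
  sgn≡ s = ≡.trans
    (sgn-cong π permutation λ i → ++-injective
      (≡.trans (uv≡w i) (≡.sym (≡.trans (≡.cong [ u , v ]′ (Fin.splitAt-join m n (to i))) (values i)))))
    sign
    where open Shuffle (split⇒shuffle s u v w ≡.refl ≡.refl ≡.refl)

-- The entries of an overlap are, as a set, those of `μ` and `ν` together, and a decreasing list is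
-- determined by its set of elements.
overlap-unique : ∀ m n μ ν κ κ′ → IsOverlap m n μ ν κ → IsOverlap m n μ ν κ′ → κ ≡ κ′
overlap-unique m n μ ν κ κ′ o o′ = entries-injective (m ℕ.+ n) (proj₁ o) (proj₁ o′)
  (decreasing-≡ (entries-decreasing (m ℕ.+ n) κ) (entries-decreasing (m ℕ.+ n) κ′)
    (λ z∈ → [ O′.∈-entriesˡ , O′.∈-entriesʳ ]′ (O.∈-entries⁻ z∈))
    (λ z∈ → [ O.∈-entriesˡ , O.∈-entriesʳ ]′ (O′.∈-entries⁻ z∈)))
  where
  module O  = Overlap m n μ ν κ o
  module O′ = Overlap m n μ ν κ′ o′

⋆-complete : ∀ m n μ ν κ → IsOverlap m n μ ν κ → μ ⋆[ m , n ] ν ≡ just κ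
⋆-complete m n μ ν κ o with overlap? m n μ ν
... | yes (κ′ , o′) = ≡.cong just (overlap-unique m n μ ν κ′ κ o′ o)
... | no ∄κ        = contradiction (κ , o) ∄κ

-- The search in `overlap?` may return another partition and another permutation than those at hand;
-- `overlap-unique` identifies the former and `sgn≡` makes the sign independent of the latter.
ε≡ : ∀ m n μ ν κ {σ} → IsOverlap m n μ ν κ → Split σ (entries m μ) (entries n ν) (entries (m ℕ.+ n) κ) → ε m n μ ν ≡ σ
ε≡ m n μ ν κ o s with overlap? m n μ ν
... | no ∄κ = contradiction (κ , o) ∄κ
... | yes (κ′ , o′) with ≡.refl ← overlap-unique m n μ ν κ κ′ o o′ = Overlap.sgn≡ m n μ ν κ o′ s

split⇒overlap : ∀ m n μ ν κ {σ} → length κ ≤ m ℕ.+ n →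
                Split σ (entries m μ) (entries n ν) (entries (m ℕ.+ n) κ) → IsOverlap m n μ ν κ
split⇒overlap m n μ ν κ lκ s = lκ , permutation , λ i →
  ≡.trans (≡.cong [ u , v ]′ (Fin.splitAt-join m n (to i))) (values i)
  where
  u = pad m μ ⊹ ρ m
  v = pad n ν ⊹ ρ n
  open Shuffle (split⇒shuffle s u v (pad (m ℕ.+ n) κ ⊹ ρ (m ℕ.+ n)) ≡.refl ≡.refl ≡.refl)

-- Injectivity is asked only on members of the list because `entries m` forgets parts beyond the
-- first `m`: it is injective only on partitions of length at most `m`.
unique-map⁺ : ∀ {f : A → B} {xs} → (∀ {x y} → x ∈ xs → y ∈ xs → f x ≡ f y → x ≡ y) → Unique xs → Unique (map f xs)
unique-map⁺ inj []         = []
unique-map⁺ inj (x≢ ∷ xs≢) =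
  All.map⁺ (All.tabulate λ y∈ fx≡fy → All.lookup x≢ y∈ (inj (here ≡.refl) (there y∈) fx≡fy)) ∷
  unique-map⁺ (λ x∈ y∈ → inj (there x∈) (there y∈)) xs≢

leftLength? : ∀ m → Decidable λ (s : Sign × List ℕ × List ℕ) → List.length (proj₁ (proj₂ s)) ≡ m
leftLength? m (_ , as , _) = List.length as ℕ.≟ m

signedEntries : ∀ m n → Partition × Partition → Sign × List ℕ × List ℕ
signedEntries m n (μ , ν) = ε m n μ ν , entries m μ , entries n ν

module _ (m n : ℕ) (κ : Partition) (lκ : length κ ≤ m ℕ.+ n) where
  open Enumeration (overlapPairs m n κ)

  -- Both lists are free of repetitions, so it suffices that they have the same members.
  -- `Overlap.split` turns a pair into a division; conversely the parts of a division inherit strict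
  -- decrease, and `fromEntries` recovers the partitions.
  overlapPairs↭splits : map (signedEntries m n) elements ↭ˡ filter (leftLength? m) (splits (entries (m ℕ.+ n) κ))
  overlapPairs↭splits = ∼bag⇒↭ (unique∧set⇒bag
    (unique-map⁺ (λ {μν} {μν′} → injective {μν} {μν′}) unique)
    (Unique.filter⁺ (leftLength? m) (splits-unique (AllPairs.map ℕ.>⇒≢ (entries-decreasing (m ℕ.+ n) κ))))
    (mk⇔ to from))
    where
    injective : ∀ {μν μν′} → μν ∈ elements → μν′ ∈ elements → signedEntries m n μν ≡ signedEntries m n μν′ → μν ≡ μν′
    injective μν∈ μν′∈ eq with lμ , lν , _ ← All.lookup sound μν∈ | lμ′ , lν′ , _ ← All.lookup sound μν′∈ =
      ≡.cong₂ _,_ (entries-injective m lμ lμ′ (≡.cong (proj₁ ∘ proj₂) eq))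
                  (entries-injective n lν lν′ (≡.cong (proj₂ ∘ proj₂) eq))

    to : ∀ {s} → s ∈ map (signedEntries m n) elements → s ∈ filter (leftLength? m) (splits (entries (m ℕ.+ n) κ))
    to s∈ with (μ , ν) , μν∈ , ≡.refl ← ∈-map⁻ (signedEntries m n) s∈ with _ , _ , eq ← All.lookup sound μν∈
      with o ← ⋆-sound {m} {n} {μ} {ν} eq with σ , s ← Overlap.split m n μ ν κ o =
        ∈-filter⁺ (leftLength? m)
          (≡.subst (λ τ → (τ , entries m μ , entries n ν) ∈ splits (entries (m ℕ.+ n) κ)) (≡.sym (ε≡ m n μ ν κ o s)) (∈-splits⁺ s))
          (List.length-tabulate (pad m μ ⊹ ρ m))

    from : ∀ {s} → s ∈ filter (leftLength? m) (splits (entries (m ℕ.+ n) κ)) → s ∈ map (signedEntries m n) elements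
    from {σ , as , bs} s∈ with s∈′ , la ← ∈-filter⁻ (leftLength? m) {xs = splits (entries (m ℕ.+ n) κ)} s∈
      with s ← ∈-splits⁻ (entries (m ℕ.+ n) κ) s∈′
      with as> , bs> ← split-AllPairs s (entries-decreasing (m ℕ.+ n) κ)
      with μ , lμ , μ≡ ← fromEntries as> | ν , lν , ν≡ ← fromEntries bs> =
        ≡.subst (_∈ map (signedEntries m n) elements) eq (∈-map⁺ (signedEntries m n) (complete
          (≡.subst (length μ ≤_) la lμ , ≡.subst (length ν ≤_) lb lν , ⋆-complete m n μ ν κ o)))
      where
      -- The filter fixes the size of the left part only; the right one is what remains of `m + n`.
      lb : List.length bs ≡ n
      lb = ℕ.+-cancelˡ-≡ m _ _ (≡.trans (≡.cong (ℕ._+ List.length bs) (≡.sym la))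
        (≡.trans (split-length s) (List.length-tabulate (pad (m ℕ.+ n) κ ⊹ ρ (m ℕ.+ n)))))

      μ≡as : entries m μ ≡ as
      μ≡as = ≡.trans (≡.cong (λ k → entries k μ) (≡.sym la)) μ≡

      ν≡bs : entries n ν ≡ bs
      ν≡bs = ≡.trans (≡.cong (λ k → entries k ν) (≡.sym lb)) ν≡

      s′ : Split σ (entries m μ) (entries n ν) (entries (m ℕ.+ n) κ)
      s′ = ≡.subst₂ (λ as bs → Split σ as bs (entries (m ℕ.+ n) κ)) (≡.sym μ≡as) (≡.sym ν≡bs) s

      o : IsOverlap m n μ ν κ
      o = split⇒overlap m n μ ν κ lκ s′

      eq : signedEntries m n (μ , ν) ≡ (σ , as , bs)
      eq = ≡.cong₂ _,_ (ε≡ m n μ ν κ o s′) (≡.cong₂ _,_ μ≡as ν≡bs)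

-- Ring homomorphisms

module Homomorphism (A : CommutativeRing c ℓ) (R : CommutativeRing c′ ℓ′) where
  private
    module A = CommutativeRing A
    module R = CommutativeRing R
  open RingMorphisms A.rawRing R.rawRing using (IsRingHomomorphism) public

  module Properties (h : A.Carrier → R.Carrier) (isHom : IsRingHomomorphism h) where
    open IsRingHomomorphism isHom
    open CommutativeRing R using (_≈_)
    private
      module PA = PolynomialRing A
      module PR = PolynomialRing R
      module VA = Vandermonde A
      module VR = Vandermonde R
      module DA = AlternantDivisibility A
      module DR = AlternantDivisibility R
      module LA = ListSum A
      module LR = ListSum R
    open import Algebra.Properties.Semiring.Sum A.semiring using () renaming (sum to sumᴬ)
    open import Algebra.Properties.Semiring.Sum R.semiring using (sum; sum-cong-≋)
    open import Algebra.Properties.Semiring.Exp A.semiring using () renaming (_^_ to _^ᴬ_)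
    open import Algebra.Properties.Semiring.Exp R.semiring using (_^_)

    sum-homo : ∀ {n} (f : Vector A.Carrier n) → h (sumᴬ f) ≈ sum (h ∘ f)
    sum-homo {zero}  f = 0#-homo
    sum-homo {suc n} f = R.trans (+-homo _ _) (R.+-congˡ (sum-homo (tail f)))

    product-homo : ∀ {n} (f : Vector A.Carrier n) → h (VA.product f) ≈ VR.product (h ∘ f)
    product-homo {zero}  f = 1#-homo
    product-homo {suc n} f = R.trans (*-homo _ _) (R.*-congˡ (product-homo (tail f)))

    -1#-homo : h (A.- A.1#) ≈ R.- R.1#
    -1#-homo = R.trans (-‿homo _) (R.-‿cong 1#-homo)

    -1^-homo : ∀ k → h ((A.- A.1#) ^ᴬ k) ≈ (R.- R.1#) ^ k
    -1^-homo zero    = 1#-homo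
    -1^-homo (suc k) = R.trans (*-homo _ _) (R.*-cong -1#-homo (-1^-homo k))

    listSum-homo : ∀ (f : X → A.Carrier) xs → h (LA.listSum f xs) ≈ LR.listSum (h ∘ f) xs
    listSum-homo f []       = 0#-homo
    listSum-homo f (x ∷ xs) = R.trans (+-homo _ _) (R.+-congˡ (listSum-homo f xs))

    signed-homo : ∀ σ → h (LA.signed σ) ≈ LR.signed σ
    signed-homo Sign.+ = 1#-homo
    signed-homo Sign.- = -1#-homo

    infix 4 _~_ _~ₚ_

    _~_ : A.Carrier → R.Carrier → Set ℓ′
    a ~ b = h a ≈ b

    -- Finer than equality up to trailing zeros: the lists must have equal length. This is
    -- affordable because the division recipe never inspects a coefficient, so both runs produce
    -- lists of the same shape.
    _~ₚ_ : PA.Polynomial → PR.Polynomial → Set (c ⊔ c′ ⊔ ℓ′)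
    _~ₚ_ = Pointwise _~_

    +ₚ-homo : ∀ {p p′ q q′} → p ~ₚ p′ → q ~ₚ q′ → p PA.+ₚ q ~ₚ p′ PR.+ₚ q′
    +ₚ-homo []        q~       = q~
    +ₚ-homo (a~ ∷ p~) []       = a~ ∷ p~
    +ₚ-homo (a~ ∷ p~) (b~ ∷ q~) = R.trans (+-homo _ _) (R.+-cong a~ b~) ∷ +ₚ-homo p~ q~

    scale-homo : ∀ {a a′ p p′} → a ~ a′ → p ~ₚ p′ → PA.scale a p ~ₚ PR.scale a′ p′
    scale-homo a~ []        = []
    scale-homo a~ (b~ ∷ p~) = R.trans (*-homo _ _) (R.*-cong a~ b~) ∷ scale-homo a~ p~

    neg-homo : ∀ {p p′} → p ~ₚ p′ → PA.-ₚ p ~ₚ PR.-ₚ p′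
    neg-homo []        = []
    neg-homo (a~ ∷ p~) = R.trans (-‿homo _) (R.-‿cong a~) ∷ neg-homo p~

    horner-homo : ∀ {p p′ t t′} → p ~ₚ p′ → t ~ t′ → DA.horner p t ~ DR.horner p′ t′
    horner-homo []        t~ = 0#-homo
    horner-homo (a~ ∷ p~) t~ = R.trans (+-homo _ _) (R.+-cong a~ (R.trans (*-homo _ _) (R.*-cong t~ (horner-homo p~ t~))))

    quotient-homo : ∀ {p p′ y y′} → y ~ y′ → p ~ₚ p′ → DA.quotient y p ~ₚ DR.quotient y′ p′
    quotient-homo y~ []        = []
    quotient-homo y~ (a~ ∷ p~) = +ₚ-homo (neg-homo p~) (scale-homo y~ (quotient-homo y~ p~))

    monomial-homo : ∀ e → DA.monomial e ~ₚ DR.monomial e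
    monomial-homo zero    = 1#-homo ∷ []
    monomial-homo (suc e) = 0#-homo ∷ monomial-homo e

    -- Where Δ vanishes, the equation for the quotient does not determine it, so the recipe itself
    -- is followed: each of its ring operations commutes with `h`.
    divisible-homo : ∀ {n} {x : Vector A.Carrier n} {x′ g g′} → (∀ i → x i ~ x′ i) → (∀ j → g j ~ₚ g′ j) →
                     proj₁ (DA.divisible x g) ~ proj₁ (DR.divisible x′ g′)
    divisible-homo {zero}  x~ g~ = 1#-homo
    divisible-homo {suc n} {x} {x′} {g} {g′} x~ g~ = R.trans
      (sum-homo λ j → (A.- A.1#) ^ᴬ toℕ j A.* (DA.horner (g j) (head x) A.*
        proj₁ (DA.divisible (tail x) λ k → DA.quotient (head x) (g (punchIn j k)))))
      (sum-cong-≋ λ j → R.trans (*-homo _ _) (R.*-cong (-1^-homo (toℕ j)) (R.trans (*-homo _ _)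
        (R.*-cong (horner-homo (g~ j) (x~ zero))
          (divisible-homo (x~ ∘ suc) λ k → quotient-homo (x~ zero) (g~ (punchIn j k)))))))

    alternant-divisible-homo : ∀ {n} {x : Vector A.Carrier n} {x′} (e : Vector ℕ n) → (∀ i → x i ~ x′ i) →
      proj₁ (DA.alternant-divisible x e) ~ proj₁ (DR.alternant-divisible x′ e)
    alternant-divisible-homo e x~ = divisible-homo x~ (monomial-homo ∘ e)

    Δ⨾-homo : ∀ {m n} {x : Vector A.Carrier m} {y : Vector A.Carrier n} {x′ y′} →
              (∀ i → x i ~ x′ i) → (∀ j → y j ~ y′ j) → VA.Δ[ x ⨾ y ] ~ VR.Δ[ x′ ⨾ y′ ]
    Δ⨾-homo {m} {n} {x} {y} {x′} {y′} x~ y~ = R.trans (product-homo λ i → VA.product λ j → x i A.- y j)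
      (product-cong {m} λ i → R.trans (product-homo λ j → x i A.- y j)
        (product-cong {n} λ j → R.trans (+-homo _ _) (R.+-cong (x~ i) (R.trans (-‿homo _) (R.-‿cong (y~ j))))))
      where open import Algebra.Properties.CommutativeMonoid.Sum R.*-commutativeMonoid using () renaming (sum-cong-≋ to product-cong)

module Evaluation (A : CommutativeRing c ℓ) (R : CommutativeRing c′ ℓ′) (h : CommutativeRing.Carrier A → CommutativeRing.Carrier R)
                  (isHom : Homomorphism.IsRingHomomorphism A R h) (t : CommutativeRing.Carrier R) where
  private
    module A = CommutativeRing A
    module H = Homomorphism.IsRingHomomorphism A R isHom
  open CommutativeRing R hiding (zero)
  open import Algebra.Properties.Ring ring
  open import Algebra.Solver.Ring.NaturalCoefficients.Default commutativeSemiring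
    using (solve; _:=_; _:+_; _:*_)
  open import Relation.Binary.Reasoning.Setoid setoid
  open PolynomialRing A

  evalAt : Polynomial → Carrier
  evalAt = List.foldr (λ a b → h a + t * b) 0#

  evalAt-0 : ∀ {p} → p ≈ₚ [] → evalAt p ≈ 0#
  evalAt-0 {[]}    p≈0 = refl
  evalAt-0 {a ∷ p} p≈0 = begin
    h a + t * evalAt p ≈⟨ +-cong (trans (H.⟦⟧-cong (p≈0 0)) H.0#-homo) (trans (*-congˡ (evalAt-0 {p} (p≈0 ∘ suc))) (zeroʳ t)) ⟩
    0# + 0#            ≈⟨ +-identityˡ 0# ⟩
    0#                 ∎

  -- Equal polynomials may be lists of different lengths; the surplus coefficients are zero and
  -- `evalAt-0` disposes of them.
  evalAt-cong : ∀ {p q} → p ≈ₚ q → evalAt p ≈ evalAt q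
  evalAt-cong {[]}    {q}     p≈q = sym (evalAt-0 {q} λ i → A.sym (p≈q i))
  evalAt-cong {a ∷ p} {[]}    p≈q = evalAt-0 {a ∷ p} p≈q
  evalAt-cong {a ∷ p} {b ∷ q} p≈q = +-cong (H.⟦⟧-cong (p≈q 0)) (*-congˡ (evalAt-cong {p} {q} (p≈q ∘ suc)))

  evalAt-+ : ∀ p q → evalAt (p +ₚ q) ≈ evalAt p + evalAt q
  evalAt-+ []      q       = sym (+-identityˡ _)
  evalAt-+ (a ∷ p) []      = sym (+-identityʳ _)
  evalAt-+ (a ∷ p) (b ∷ q) = begin
    h (a A.+ b) + t * evalAt (p +ₚ q)
      ≈⟨ +-cong (H.+-homo a b) (*-congˡ (evalAt-+ p q)) ⟩
    h a + h b + t * (evalAt p + evalAt q)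
      ≈⟨ solve 5 (λ a b t p q → a :+ b :+ t :* (p :+ q) := (a :+ t :* p) :+ (b :+ t :* q)) refl (h a) (h b) t (evalAt p) (evalAt q) ⟩
    evalAt (a ∷ p) + evalAt (b ∷ q) ∎

  evalAt-scale : ∀ a p → evalAt (scale a p) ≈ h a * evalAt p
  evalAt-scale a []      = sym (zeroʳ _)
  evalAt-scale a (b ∷ p) = begin
    h (a A.* b) + t * evalAt (scale a p)
      ≈⟨ +-cong (H.*-homo a b) (*-congˡ (evalAt-scale a p)) ⟩
    h a * h b + t * (h a * evalAt p)
      ≈⟨ solve 4 (λ a b t p → a :* b :+ t :* (a :* p) := a :* (b :+ t :* p)) refl (h a) (h b) t (evalAt p) ⟩
    h a * evalAt (b ∷ p) ∎

  evalAt-* : ∀ p q → evalAt (p *ₚ q) ≈ evalAt p * evalAt q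
  evalAt-* []      q = sym (zeroˡ _)
  evalAt-* (a ∷ p) q = begin
    evalAt (scale a q +ₚ (A.0# ∷ p *ₚ q))
      ≈⟨ evalAt-+ (scale a q) _ ⟩
    evalAt (scale a q) + (h A.0# + t * evalAt (p *ₚ q))
      ≈⟨ +-cong (evalAt-scale a q) (trans (+-cong H.0#-homo (*-congˡ (evalAt-* p q))) (+-identityˡ _)) ⟩
    h a * evalAt q + t * (evalAt p * evalAt q)
      ≈⟨ solve 4 (λ a q t p → a :* q :+ t :* (p :* q) := (a :+ t :* p) :* q) refl (h a) (evalAt q) t (evalAt p) ⟩
    evalAt (a ∷ p) * evalAt q ∎

  evalAt-neg : ∀ p → evalAt (-ₚ p) ≈ - evalAt p
  evalAt-neg []      = sym -0#≈0#
  evalAt-neg (a ∷ p) = begin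
    h (A.- a) + t * evalAt (-ₚ p) ≈⟨ +-cong (H.-‿homo a) (trans (*-congˡ (evalAt-neg p)) (sym (-‿distribʳ-* _ _))) ⟩
    - h a + - (t * evalAt p)      ≈⟨ -‿+-comm _ _ ⟩
    - evalAt (a ∷ p)              ∎

  evalAt-constant : ∀ a → evalAt (constant a) ≈ h a
  evalAt-constant a = trans (+-congˡ (zeroʳ t)) (+-identityʳ _)

  isRingHomomorphism : Homomorphism.IsRingHomomorphism commutativeRing R evalAt
  isRingHomomorphism = record
    { isSemiringHomomorphism = record
      { isNearSemiringHomomorphism = record
        { +-isMonoidHomomorphism = record
          { isMagmaHomomorphism = record
            { isRelHomomorphism = record { cong = λ {p} {q} → evalAt-cong {p} {q} }
            ; homo = evalAt-+
            }
          ; ε-homo = refl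
          }
        ; *-homo = evalAt-*
        }
      ; 1#-homo = trans (evalAt-constant A.1#) H.1#-homo
      }
    ; -‿homo = evalAt-neg
    }

module EvalProperties (R : CommutativeRing c ℓ) where
  open CommutativeRing R hiding (zero; ring)
  open MvPolynomial R

  eval-isRingHomomorphism : ∀ {n} (x : Vector Carrier n) → Homomorphism.IsRingHomomorphism (ring n) R (eval x)
  eval-isRingHomomorphism {zero}  x = record
    { isSemiringHomomorphism = record
      { isNearSemiringHomomorphism = record
        { +-isMonoidHomomorphism = record
          { isMagmaHomomorphism = record
            { isRelHomomorphism = record { cong = λ p≈q → p≈q }
            ; homo = λ _ _ → refl
            }
          ; ε-homo = refl
          }
        ; *-homo = λ _ _ → refl
        }
      ; 1#-homo = refl
      }
    ; -‿homo = λ _ → refl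
    }
  eval-isRingHomomorphism {suc n} x =
    Evaluation.isRingHomomorphism (ring n) R (eval (tail x)) (eval-isRingHomomorphism (tail x)) (head x)

  eval-var : ∀ {n} (x : Vector Carrier n) i → eval x (var n i) ≈ x i
  eval-var {suc n} x zero    = trans (+-cong H.0#-homo (*-congˡ (trans (+-cong H.1#-homo (zeroʳ _)) (+-identityʳ _))))
    (trans (+-identityˡ _) (*-identityʳ _))
    where module H = Homomorphism.IsRingHomomorphism (ring n) R (eval-isRingHomomorphism (tail x))
  eval-var {suc n} x (suc i) = trans (+-congˡ (zeroʳ _)) (trans (+-identityʳ _) (eval-var (tail x) i))

  open Schur R

  -- Obtained from naturality of the division recipe and not by cancelling Δ, hence valid at points
  -- with repeated coordinates.
  eval-schurPolynomial : ∀ {n} κ (x : Vector Carrier n) →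
    eval x (SchurPolynomial.poly (schurPolynomial n κ)) ≈
    proj₁ (AlternantDivisibility.alternant-divisible R x (pad n κ ⊹ ρ n))
  eval-schurPolynomial {n} κ x =
    Homomorphism.Properties.alternant-divisible-homo (ring n) R (eval x) (eval-isRingHomomorphism x)
      (pad n κ ⊹ ρ n) (eval-var x)

-- Vandermonde products

tail-++ : ∀ {m n} (u : Vector A (suc m)) (v : Vector A n) i → (u ++ v) (suc i) ≡ (tail u ++ v) i
tail-++ {m = m} u v i = Sum.[,]-map (splitAt m i)

tabulate-++ : ∀ {m n} (u : Vector A m) (v : Vector A n) → tabulate (u ++ v) ≡ tabulate u List.++ tabulate v
tabulate-++ {m = zero}  u v = ≡.refl
tabulate-++ {m = suc m} u v = ≡.cong (head u ∷_) (≡.trans (List.tabulate-cong (tail-++ u v)) (tabulate-++ (tail u) v))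

module VandermondeProperties (R : CommutativeRing c ℓ) where
  open CommutativeRing R hiding (zero)
  open Vandermonde R
  open PairProduct *-commutativeMonoid
  open PairProductProperties *-commutativeMonoid
  open import Algebra.Properties.CommutativeMonoid.Sum *-commutativeMonoid
    using () renaming (sum-cong-≋ to product-cong)
  open import Algebra.Solver.Ring.NaturalCoefficients.Default commutativeSemiring
    using (solve; _:=_; _:*_)
  open import Relation.Binary.Reasoning.Setoid setoid

  Δ-cong : ∀ {n} {x y : Vector Carrier n} → (∀ i → x i ≈ y i) → Δ x ≈ Δ y
  Δ-cong x≈y = pairs-cong λ i j → +-cong (x≈y i) (-‿cong (x≈y j))

  product-++ : ∀ {m n} (f : A → Carrier) (u : Vector A m) (v : Vector A n) →
               product (f ∘ (u ++ v)) ≈ product (f ∘ u) * product (f ∘ v)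
  product-++ {m = zero}  f u v = sym (*-identityˡ _)
  product-++ {m = suc m} {n} f u v = begin
    f (head u) * product (f ∘ tail (u ++ v))
      ≈⟨ *-congˡ (product-cong {m ℕ.+ n} λ i → reflexive (≡.cong f (tail-++ u v i))) ⟩
    f (head u) * product (f ∘ (tail u ++ v))
      ≈⟨ *-congˡ (product-++ f (tail u) v) ⟩
    f (head u) * (product (f ∘ tail u) * product (f ∘ v))
      ≈⟨ *-assoc _ _ _ ⟨
    product (f ∘ u) * product (f ∘ v) ∎

  Δ-++ : ∀ {m n} (x : Vector Carrier m) (y : Vector Carrier n) → Δ (x ++ y) ≈ Δ[ x ⨾ y ] * (Δ x * Δ y)
  Δ-++ {zero}  x y = sym (trans (*-identityˡ _) (*-identityˡ _))
  Δ-++ {suc m} {n} x y = begin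
    product (λ j → head x - tail (x ++ y) j) * Δ (tail (x ++ y))
      ≈⟨ *-cong (product-cong {m ℕ.+ n} λ j → +-congˡ (-‿cong (reflexive (tail-++ x y j))))
                (Δ-cong λ i → reflexive (tail-++ x y i)) ⟩
    product (λ j → head x - (tail x ++ y) j) * Δ (tail x ++ y)
      ≈⟨ *-cong (product-++ (λ z → head x - z) (tail x) y) (Δ-++ (tail x) y) ⟩
    product (λ j → head x - tail x j) * product (λ j → head x - y j) * (Δ[ tail x ⨾ y ] * (Δ (tail x) * Δ y))
      ≈⟨ solve 5 (λ a b c d e → a :* b :* (c :* (d :* e)) := b :* c :* (a :* d :* e)) refl _ _ _ _ _ ⟩
    Δ[ x ⨾ y ] * (Δ x * Δ y) ∎

-- Non-zero-divisors and the Vandermonde product of indeterminates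

module RegularElements (R : CommutativeRing c ℓ) where
  open CommutativeRing R hiding (zero)
  open import Algebra.Properties.Ring ring
  open PairProduct *-commutativeMonoid
  open Vandermonde R using (product)
  open import Relation.Binary.Reasoning.Setoid setoid

  Regular : Carrier → Set (c ⊔ ℓ)
  Regular z = ∀ w → z * w ≈ 0# → w ≈ 0#

  regular-≈ : ∀ {y z} → y ≈ z → Regular y → Regular z
  regular-≈ y≈z ry w zw≈0 = ry w (trans (*-congʳ y≈z) zw≈0)

  regular-1 : Regular 1#
  regular-1 w 1w≈0 = trans (sym (*-identityˡ w)) 1w≈0

  regular-* : ∀ {y z} → Regular y → Regular z → Regular (y * z)
  regular-* ry rz w yzw≈0 = rz w (ry _ (trans (sym (*-assoc _ _ _)) yzw≈0))

  regular-*⁻ : ∀ {y z} → Regular (y * z) → Regular z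
  regular-*⁻ ryz w zw≈0 = ryz w (trans (*-assoc _ _ _) (trans (*-congˡ zw≈0) (zeroʳ _)))

  regular-cancel : ∀ {x y z} → Regular z → x * z ≈ y * z → x ≈ y
  regular-cancel {x} {y} {z} rz xz≈yz = x-y≈0⇒x≈y (rz (x - y) (begin
    z * (x - y)       ≈⟨ *-comm _ _ ⟩
    (x - y) * z       ≈⟨ distribʳ _ _ _ ⟩
    x * z + - y * z   ≈⟨ +-cong xz≈yz (sym (-‿distribˡ-* _ _)) ⟩
    y * z - y * z     ≈⟨ -‿inverseʳ _ ⟩
    0#                ∎))
    where
    x-y≈0⇒x≈y : ∀ {x y} → x - y ≈ 0# → x ≈ y
    x-y≈0⇒x≈y = x∙y⁻¹≈ε⇒x≈y _ _

  product-regular : ∀ {n} (f : Vector Carrier n) → (∀ i → Regular (f i)) → Regular (product f)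
  product-regular {zero}  f rf = regular-1
  product-regular {suc n} f rf = regular-* (rf zero) (product-regular (tail f) (rf ∘ suc))

  pairs-regular : ∀ {n} (f : Fin n → Fin n → Carrier) → (∀ i j → i Fin.< j → Regular (f i j)) → Regular (pairs f)
  pairs-regular {zero}  f rf = regular-1
  pairs-regular {suc n} f rf = regular-* (product-regular _ λ j → rf zero (suc j) (s≤s z≤n))
    (pairs-regular (λ i j → f (suc i) (suc j)) λ i j i<j → rf (suc i) (suc j) (s≤s i<j))

module RegularPolynomials (R : CommutativeRing c ℓ) where
  open CommutativeRing R hiding (zero)
  open PolynomialRing R hiding (commutativeRing)
  open RegularElements R
  open RegularElements (PolynomialRing.commutativeRing R) using () renaming (Regular to Regularₚ)
  open import Relation.Binary.Reasoning.Setoid setoid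

  coeff-constant-* : ∀ a p i → coeff (constant a *ₚ p) i ≈ a * coeff p i
  coeff-constant-* a p i = begin
    coeff (scale a p +ₚ (0# ∷ [])) i        ≈⟨ coeff-+ (scale a p) (0# ∷ []) i ⟩
    coeff (scale a p) i + coeff (0# ∷ []) i ≈⟨ +-cong (coeff-scale a p i) (coeff-0 i) ⟩
    a * coeff p i + 0#                      ≈⟨ +-identityʳ _ ⟩
    a * coeff p i                           ∎
    where
    coeff-0 : ∀ i → coeff (0# ∷ []) i ≈ 0#
    coeff-0 zero    = refl
    coeff-0 (suc i) = refl

  constant-regular : ∀ {a} → Regular a → Regularₚ (constant a)
  constant-regular {a} ra p ap≈0 i = ra _ (trans (sym (coeff-constant-* a p i)) (ap≈0 i))

  -- The coefficients of a multiple of a monic linear polynomial determine those of the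
  -- cofactor from the top down.
  linear-regular : ∀ a → Regularₚ (a ∷ 1# ∷ [])
  linear-regular a p lp≈0 = vanish p λ i → begin
    a * coeff p (suc i) + coeff p i
      ≈⟨ +-cong (coeff-scale a p (suc i)) (*ₚ-identityˡ p i) ⟨
    coeff (scale a p) (suc i) + coeff (constant 1# *ₚ p) i
      ≈⟨ coeff-+ (scale a p) (0# ∷ constant 1# *ₚ p) (suc i) ⟨
    coeff ((a ∷ 1# ∷ []) *ₚ p) (suc i)
      ≈⟨ lp≈0 (suc i) ⟩
    0# ∎
    where
    vanish : ∀ p → (∀ i → a * coeff p (suc i) + coeff p i ≈ 0#) → p ≈ₚ []
    vanish []      rec i       = refl
    vanish (b ∷ p) rec (suc i) = vanish p (rec ∘ suc) i
    vanish (b ∷ p) rec zero    = begin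
      b                ≈⟨ +-identityˡ b ⟨
      0# + b           ≈⟨ +-congʳ (trans (*-congˡ (vanish p (rec ∘ suc) 0)) (zeroʳ a)) ⟨
      a * coeff p 0 + b ≈⟨ rec 0 ⟩
      0#               ∎

module Generic (R : CommutativeRing c ℓ) where
  open MvPolynomial R
  open RegularElements using (Regular; pairs-regular)

  -- In the nested construction `var n i` with the smaller index is the outer variable after
  -- finitely many layers of constants are stripped. There the difference is monic and linear over
  -- the ring in the later variables.
  var-regular : ∀ n (i j : Fin n) → i Fin.< j →
                Regular (ring n) (CommutativeRing._-_ (ring n) (var n i) (var n j))
  var-regular (suc n) zero    (suc j) _ = RegularPolynomials.linear-regular (ring n) _
  var-regular (suc n) (suc i) (suc j) (s≤s i<j) = RegularPolynomials.constant-regular (ring n) (var-regular n i j i<j)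

  Δ-var-regular : ∀ n → Regular (ring n) (Vandermonde.Δ (ring n) (var n))
  Δ-var-regular n = pairs-regular (ring n) _ (var-regular n)

-- The expansion under regularity

module OverlapExpansion (R : CommutativeRing c ℓ) where
  open CommutativeRing R hiding (zero)
  open import Algebra.Properties.Semiring.Exp semiring using (_^_)
  open import Algebra.Solver.Ring.NaturalCoefficients.Default commutativeSemiring
    using (solve; _:=_; _:*_)
  open import Relation.Binary.Reasoning.Setoid setoid
  open Vandermonde R
  open VandermondeProperties R
  open ListSum R
  open Laplace R _^_
  open AlternantDivisibility R using (alternant-divisible)
  open RegularElements R

  -- A value of det / Δ at an arbitrary point, determined uniquely only when Δ is regular.
  quotientSchur : ∀ {n} → Partition → Vector Carrier n → Carrier
  quotientSchur {n} κ x = proj₁ (alternant-divisible x (pad n κ ⊹ ρ n))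

  detₗ-entries : ∀ {n} κ (x : Vector Carrier n) → detₗ (tabulate x) (entries n κ) ≈ quotientSchur κ x * Δ x
  detₗ-entries {n} κ x = sym (trans (proj₂ (alternant-divisible x (pad n κ ⊹ ρ n))) (det≈detₗ x (pad n κ ⊹ ρ n)))

  overlapTerm : ∀ {m n} → Vector Carrier m → Vector Carrier n → Partition × Partition → Carrier
  overlapTerm {m} {n} x y (μ , ν) = signed (ε m n μ ν) * quotientSchur μ x * quotientSchur ν y

  overlap-expansion : ∀ {m n} κ (x : Vector Carrier m) (y : Vector Carrier n) → length κ ℕ.≤ m ℕ.+ n → Regular (Δ x * Δ y) →
    quotientSchur κ (x ++ y) * Δ[ x ⨾ y ] ≈ listSum (overlapTerm x y) (Enumeration.elements (overlapPairs m n κ))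
  overlap-expansion {m} {n} κ x y lκ regular = regular-cancel regular (begin
    quotientSchur κ (x ++ y) * Δ[ x ⨾ y ] * (Δ x * Δ y)
      ≈⟨ *-assoc _ _ _ ⟩
    quotientSchur κ (x ++ y) * (Δ[ x ⨾ y ] * (Δ x * Δ y))
      ≈⟨ *-congˡ (Δ-++ x y) ⟨
    quotientSchur κ (x ++ y) * Δ (x ++ y)
      ≈⟨ detₗ-entries κ (x ++ y) ⟨
    detₗ (tabulate (x ++ y)) (entries (m ℕ.+ n) κ)
      ≈⟨ reflexive (≡.cong (λ rs → detₗ rs (entries (m ℕ.+ n) κ)) (tabulate-++ x y)) ⟩
    detₗ (tabulate x List.++ tabulate y) (entries (m ℕ.+ n) κ)
      ≈⟨ laplace (tabulate x) (tabulate y) (entries (m ℕ.+ n) κ) ⟩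
    listSum splitTerm (splits (entries (m ℕ.+ n) κ))
      -- Laplace expansion runs over divisions of every size; those whose left part is not of size
      -- `m` contribute a determinant of a non-square array, which is zero.
      ≈⟨ listSum-filter (leftLength? m) splitTerm (splits (entries (m ℕ.+ n) κ)) splitTerm-0 ⟨
    listSum splitTerm (filter (leftLength? m) (splits (entries (m ℕ.+ n) κ)))
      ≈⟨ listSum-↭ splitTerm (overlapPairs↭splits m n κ lκ) ⟨
    listSum splitTerm (map (signedEntries m n) elements)
      ≈⟨ listSum-map splitTerm (signedEntries m n) elements ⟩
    listSum (splitTerm ∘ signedEntries m n) elements
      ≈⟨ listSum-cong elements (λ { {μ , ν} _ → begin
        signed (ε m n μ ν) * (detₗ (tabulate x) (entries m μ) * detₗ (tabulate y) (entries n ν))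
          ≈⟨ *-congˡ (*-cong (detₗ-entries μ x) (detₗ-entries ν y)) ⟩
        signed (ε m n μ ν) * (quotientSchur μ x * Δ x * (quotientSchur ν y * Δ y))
          ≈⟨ solve 5 (λ s p d q e → s :* (p :* d :* (q :* e)) := s :* p :* q :* (d :* e)) refl _ _ _ _ _ ⟩
        overlapTerm x y (μ , ν) * (Δ x * Δ y) ∎ }) ⟩
    listSum (λ μν → overlapTerm x y μν * (Δ x * Δ y)) elements
      ≈⟨ listSum-*ʳ (Δ x * Δ y) (overlapTerm x y) elements ⟩
    listSum (overlapTerm x y) elements * (Δ x * Δ y) ∎)
    where
    open Enumeration (overlapPairs m n κ)

    splitTerm : Sign × List ℕ × List ℕ → Carrier
    splitTerm (σ , as , bs) = signed σ * (detₗ (tabulate x) as * detₗ (tabulate y) bs)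

    splitTerm-0 : ∀ s → ¬ List.length (proj₁ (proj₂ s)) ≡ m → splitTerm s ≈ 0#
    splitTerm-0 (σ , as , bs) ≢m = trans (*-congˡ (trans (*-congʳ
      (detₗ-length (tabulate x) as λ eq → ≢m (≡.trans eq (List.length-tabulate x)))) (zeroˡ _))) (zeroʳ _)

-- From indeterminates to arbitrary points

module SchurOverlap (R : CommutativeRing c ℓ) where
  open CommutativeRing R hiding (zero; ring)
  open MvPolynomial R
  open Schur R
  open Vandermonde R
  open ListSum R
  open OverlapExpansion R using (quotientSchur; overlapTerm)
  open EvalProperties R
  open import Relation.Binary.Reasoning.Setoid setoid

  schur≈quotientSchur : ∀ {n} κ (x : Vector Carrier n) → length κ ℕ.≤ n → schur κ x ≈ quotientSchur κ x
  schur≈quotientSchur {n} κ x lκ = trans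
    (reflexive (≡.cong (if_then eval x (SchurPolynomial.poly (schurPolynomial n κ)) else 0#) (dec-true (length κ ℕ.≤? n) lκ)))
    (eval-schurPolynomial κ x)

  schur≈0 : ∀ {n} κ (x : Vector Carrier n) → ¬ length κ ℕ.≤ n → schur κ x ≈ 0#
  schur≈0 {n} κ x lκ≰ =
    reflexive (≡.cong (if_then eval x (SchurPolynomial.poly (schurPolynomial n κ)) else 0#) (dec-false (length κ ℕ.≤? n) lκ≰))

  -- No regularity of `Δ x * Δ y` is assumed. The identity is the image under evaluation of the one
  -- for `ξ` and `η`, the first `m` and last `n` of the `N` indeterminates, and all its ingredients
  -- commute with `h`.
  quotientSchur-++ : ∀ {m n} κ (x : Vector Carrier m) (y : Vector Carrier n) → length κ ℕ.≤ m ℕ.+ n →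
    quotientSchur κ (x ++ y) * Δ[ x ⨾ y ] ≈ listSum (overlapTerm x y) (Enumeration.elements (overlapPairs m n κ))
  quotientSchur-++ {m} {n} κ x y lκ = begin
    quotientSchur κ (x ++ y) * Δ[ x ⨾ y ]
      ≈⟨ *-cong (H.alternant-divisible-homo (pad N κ ⊹ ρ N) eval-ξη) (H.Δ⨾-homo {m} {n} eval-ξ eval-η) ⟨
    h (G.quotientSchur κ (ξ ++ η)) * h (GV.Δ[ ξ ⨾ η ])
      ≈⟨ h.*-homo _ _ ⟨
    h (P._*_ (G.quotientSchur κ (ξ ++ η)) GV.Δ[ ξ ⨾ η ])
      ≈⟨ h.⟦⟧-cong (G.overlap-expansion κ ξ η lκ regular) ⟩
    h (ListSum.listSum (ring N) (G.overlapTerm ξ η) elements)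
      ≈⟨ H.listSum-homo (G.overlapTerm ξ η) elements ⟩
    listSum (h ∘ G.overlapTerm ξ η) elements
      ≈⟨ listSum-cong elements (λ { {μ , ν} _ → trans (h.*-homo _ _) (*-cong
           (trans (h.*-homo _ _) (*-cong (H.signed-homo (ε m n μ ν)) (H.alternant-divisible-homo (pad m μ ⊹ ρ m) eval-ξ)))
           (H.alternant-divisible-homo (pad n ν ⊹ ρ n) eval-η)) }) ⟩
    listSum (overlapTerm x y) elements ∎
    where
    open Enumeration (overlapPairs m n κ)

    N : ℕ
    N = m ℕ.+ n

    module P = CommutativeRing (ring N)
    module G = OverlapExpansion (ring N)
    module GV = Vandermonde (ring N)
    module GR = RegularElements (ring N)

    h : P.Carrier → Carrier
    h = eval (x ++ y)

    module h = Homomorphism.IsRingHomomorphism (ring N) R (eval-isRingHomomorphism (x ++ y))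
    module H = Homomorphism.Properties (ring N) R h (eval-isRingHomomorphism (x ++ y))

    ξ : Vector P.Carrier m
    ξ i = var N (i ↑ˡ n)

    η : Vector P.Carrier n
    η j = var N (m ↑ʳ j)

    ξη≡var : ∀ i → (ξ ++ η) i ≡ var N i
    ξη≡var i = ≡.trans (≡.sym (Sum.[,]-∘ (var N) (splitAt m i))) (≡.cong (var N) (Fin.join-splitAt m n i))

    eval-ξ : ∀ i → h (ξ i) ≈ x i
    eval-ξ i = trans (eval-var (x ++ y) (i ↑ˡ n)) (reflexive (≡.cong [ x , y ]′ (Fin.splitAt-↑ˡ m i n)))

    eval-η : ∀ j → h (η j) ≈ y j
    eval-η j = trans (eval-var (x ++ y) (m ↑ʳ j)) (reflexive (≡.cong [ x , y ]′ (Fin.splitAt-↑ʳ m n j)))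

    eval-ξη : ∀ i → h ((ξ ++ η) i) ≈ (x ++ y) i
    eval-ξη i = trans (reflexive (≡.cong h (ξη≡var i))) (eval-var (x ++ y) i)

    -- A factor of a regular element is regular, and Δ of all `N` indeterminates is `Δ[ ξ ⨾ η ]`
    -- times this product.
    regular : GR.Regular (P._*_ (GV.Δ ξ) (GV.Δ η))
    regular = GR.regular-*⁻ (GR.regular-≈
      (P.trans (VandermondeProperties.Δ-cong (ring N) λ i → P.reflexive (≡.sym (ξη≡var i))) (VandermondeProperties.Δ-++ (ring N) ξ η))
      (Generic.Δ-var-regular R N))

corollary3p8 : ∀ {c ℓ₁ ℓ₂} (F : HeytingField c ℓ₁ ℓ₂) → let open FieldNotation F in
    (κ : Partition) (m n : ℕ) (S : Vector Carrier m) (T : Vector Carrier n)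
    (Δ#0 : Δ[ S ⨾ T ] # 0#) →
    schur κ (S ++ T) ≈
    ∑ (overlapPairs m n κ) (λ (μ , ν) →
    ((signed (ε m n μ ν) * schur μ S * schur ν T) / Δ[ S ⨾ T ]) Δ#0)
corollary3p8 F κ m n S T Δ#0 with length κ ℕ.≤? m ℕ.+ n
-- An overlap has length at most `m + n` by definition, so no pair qualifies and the sum is zero,
-- like the Schur function in too few variables.
... | no lκ≰ = trans (schur≈0 κ (S ++ T) lκ≰) (sym (trans (listSum-cong elements λ { {μ , ν} μν∈ →
        let _ , _ , eq = All.lookup sound μν∈ in contradiction (proj₁ (⋆-sound {m} {n} {μ} {ν} eq)) lκ≰ })
      (listSum-0 elements)))
  where
  open HeytingCommutativeRing (HeytingField.heytingCommutativeRing F) using (commutativeRing)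
  open CommutativeRing commutativeRing using (sym; trans)
  open ListSum commutativeRing using (listSum-cong; listSum-0)
  open SchurOverlap commutativeRing using (schur≈0)
  open Enumeration (overlapPairs m n κ)
... | yes lκ = begin
  schur κ (S ++ T)
    ≈⟨ schur≈quotientSchur κ (S ++ T) lκ ⟩
  quotientSchur κ (S ++ T)
    ≈⟨ trans (*-assoc _ _ _) (trans (*-congˡ Δ*Δ⁻¹≈1) (*-identityʳ _)) ⟨
  quotientSchur κ (S ++ T) * Δ[ S ⨾ T ] * Δ⁻¹
    ≈⟨ *-congʳ (quotientSchur-++ κ S T lκ) ⟩
  listSum (overlapTerm S T) elements * Δ⁻¹
    ≈⟨ listSum-*ʳ Δ⁻¹ (overlapTerm S T) elements ⟨
  listSum (λ μν → overlapTerm S T μν * Δ⁻¹) elements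
    ≈⟨ listSum-cong elements (λ { {μ , ν} μν∈ → let lμ , lν , _ = All.lookup sound μν∈ in
         *-congʳ (*-cong (*-cong (signed≈ (ε m n μ ν)) (sym (schur≈quotientSchur μ S lμ))) (sym (schur≈quotientSchur ν T lν))) }) ⟩
  listSum (λ (μ , ν) → FieldNotation.signed F (ε m n μ ν) * schur μ S * schur ν T * Δ⁻¹) elements ∎
  where
  open HeytingCommutativeRing (HeytingField.heytingCommutativeRing F) using (commutativeRing; #⇒invertible)
  open CommutativeRing commutativeRing hiding (zero; ring)
  open import Relation.Binary.Reasoning.Setoid setoid
  open import Algebra.Properties.Ring (CommutativeRing.ring commutativeRing) using (-0#≈0#)
  open Schur commutativeRing using (schur)
  open Vandermonde commutativeRing using (Δ[_⨾_])
  open ListSum commutativeRing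
  open OverlapExpansion commutativeRing using (quotientSchur; overlapTerm)
  open SchurOverlap commutativeRing
  open Enumeration (overlapPairs m n κ)

  Δ⁻¹ : Carrier
  Δ⁻¹ = proj₁ (#⇒invertible Δ#0)

  -- Apartness from zero supplies an inverse of the difference `Δ[ S ⨾ T ] - 0#`, which has to be
  -- simplified first.
  Δ*Δ⁻¹≈1 : Δ[ S ⨾ T ] * Δ⁻¹ ≈ 1#
  Δ*Δ⁻¹≈1 = trans (*-congʳ (sym (trans (+-congˡ -0#≈0#) (+-identityʳ _)))) (proj₂ (proj₂ (#⇒invertible Δ#0)))

  signed≈ : ∀ σ → signed σ ≈ FieldNotation.signed F σ
  signed≈ Sign.+ = refl
  signed≈ Sign.- = refl
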